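{- Let $n\ge 4$ and $k\ge 1$, let $\tilde R$ be a quiver on $[1,n-1]$ with $b_{ij}(\tilde R)\ge 2$ whenever $i<j$, and let $Q$ be the quiver on $[1,n]$ whose full subquiver on $[1,n-1]$ is obtained from $\tilde R$ by mutating successively at $2,1,2,1,\dots,2,1$ ($2k$ mutations, starting with $2$), and whose entries $b_{in}(Q)\ge 2$ are arbitrary. Let $R$ be the quiver obtained from $Q$ by mutating at $n$ and then successively at $1,2,1,2,\dots,1,2$ ($2k$ mutations). Assume that either $n\ge 5$, or $n=4$ and $b_{14}(Q)\ne b_{23}(R)$. Consider the graph $\Gamma$ whose vertices are the classes of quivers mutation-equivalent to $Q$ modulo the equivalence generated by relabeling vertices and reversing all arrows, with an edge between two classes whenever a representative of one is obtained from a representative of the other by a single mutation. Then the class of $Q$ does not lie on any cycle of $\Gamma$ (closed walk in which no two consecutive edges or vertices coincide) of length $\le 4k+1$, and the image in $\Gamma$ of the mutation cycle of length $4k+n$ based at $Q$ given by mutating successively at $n,\ 1,2,\dots,1,2\ (2k\text{ terms}),\ n-1,\dots,2,1,\ 2,1,\dots,2,1\ (2k\text{ terms})$ cannot be paved by cycles of $\Gamma$ of length $\le 4k+1$.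
   Context: A quiver on $[1,n]$ is a finite directed multigraph with no loops and no oriented 2-cycles; quivers are labeled. It is encoded by the skew-symmetric matrix $B(Q)=(b_{ij})$, $b_{ij}>0$ meaning $b_{ij}$ arrows from $i$ to $j$. Mutation at $k$: $\mu[k](Q)$ has $b'_{ij}=-b_{ij}$ if $k\in\{i,j\}$ and $b'_{ij}=b_{ij}+\tfrac12(|b_{ik}|b_{kj}+b_{ik}|b_{kj}|)$ otherwise. A closed walk in a graph is paved by cycles of length $\le L$ if it becomes null-homotopic in the 2-complex obtained by attaching a 2-cell along every cycle of length $\le L$. -}

module Defs where

open import Data.Nat as ℕ using (ℕ; zero; suc; _≤_)
open import Data.Integer as ℤ using (ℤ; +_; -_; ∣_∣)
open import Data.Integer.DivMod using (_/ℕ_)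
open import Data.Fin using (Fin; zero; suc; _≟_; inject₁; fromℕ)
open import Data.Fin.Permutation using (Permutation′; _⟨$⟩ʳ_)
open import Data.List using (List; []; _∷_; _++_; map; drop; upTo; concat; replicate; reverse; allFin)
open import Data.List.Relation.Binary.Pointwise using (Pointwise)
open import Data.Product using (Σ; ∃; _×_)
open import Data.Sum using (_⊎_)
open import Relation.Nullary using (¬_; yes; no)
open import Relation.Binary.PropositionalEquality using (_≡_)
open import Relation.Binary.Construct.Closure.Equivalence using (EqClosure)

-- Quivers on [1,n] are encoded by their exchange matrices B(Q) = (b_ij),
-- indexed by Fin n (vertex i of [1,n] is the Fin element i-1).

Mat : ℕ → Set
Mat n = Fin n → Fin n → ℤ

-- B is the matrix of a quiver: skew-symmetric integer matrix
-- (this forces zero diagonal, i.e. no loops; no 2-cycles is automatic).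
IsQuiver : ∀ {n} → Mat n → Set
IsQuiver {n} B = ∀ (i j : Fin n) → B i j ≡ - B j i

_≋_ : ∀ {n} → Mat n → Mat n → Set
_≋_ {n} A B = ∀ (i j : Fin n) → A i j ≡ B i j

abs : ℤ → ℤ
abs x = + ∣ x ∣

μ : ∀ {n} → Fin n → Mat n → Mat n
μ k B i j with i ≟ k | j ≟ k
... | yes _ | _     = - B i j
... | no _  | yes _ = - B i j
... | no _  | no _  =
  B i j ℤ.+ ((abs (B i k) ℤ.* B k j ℤ.+ B i k ℤ.* abs (B k j)) /ℕ 2)

μs : ∀ {n} → List (Fin n) → Mat n → Mat n
μs []       B = B
μs (k ∷ ks) B = μs ks (μ k B)

walkOf : ∀ {n} → List (Fin n) → Mat n → List (Mat n)
walkOf []       B = B ∷ []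
walkOf (k ∷ ks) B = B ∷ walkOf ks (μ k B)

MutEq : ∀ {n} → Mat n → Mat n → Set
MutEq {n} Q A = Σ (List (Fin n)) λ ks → A ≋ μs ks Q

data RelabelOrReverse {n : ℕ} (A B : Mat n) : Set where
  relabel : (σ : Permutation′ n) →
            (∀ (i j : Fin n) → B i j ≡ A (σ ⟨$⟩ʳ i) (σ ⟨$⟩ʳ j)) →
            RelabelOrReverse A B
  reverseArrows : (∀ (i j : Fin n) → B i j ≡ - A i j) → RelabelOrReverse A B

_≅_ : ∀ {n} → Mat n → Mat n → Set
_≅_ = EqClosure RelabelOrReverse

-- The graph Γ(Q): vertices are ≅-classes of quivers mutation-equivalent
-- to Q, represented by matrices; a matrix represents a vertex of Γ(Q)
-- if it is ≅ to some quiver mutation-equivalent to Q.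

InΓ : ∀ {n} → Mat n → Mat n → Set
InΓ Q A = ∃ λ A′ → (A ≅ A′) × MutEq Q A′

Adj : ∀ {n} → Mat n → Mat n → Set
Adj {n} A B = Σ (Mat n) λ A′ → Σ (Mat n) λ B′ → Σ (Fin n) λ k →
  (A ≅ A′) × (B ≅ B′) × ((B′ ≋ μ k A′) ⊎ (A′ ≋ μ k B′))

-- A cycle of length ℓ in Γ(Q): a closed walk c 0, c 1, …, c ℓ = c 0
-- (encoded as an ℓ-periodic sequence of representatives) in which no two
-- consecutive vertices coincide and no two consecutive edges coincide
-- (the edges {c i, c (i+1)} and {c (i+1), c (i+2)} coincide iff
-- c i and c (i+2) are the same vertex).
record IsCycle {n : ℕ} (Q : Mat n) (ℓ : ℕ) (c : ℕ → Mat n) : Set where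
  field
    positive  : 1 ≤ ℓ
    periodic  : ∀ i → c (i ℕ.+ ℓ) ≡ c i
    inΓ       : ∀ i → InΓ Q (c i)
    adjacent  : ∀ i → Adj (c i) (c (suc i))
    noVertRep : ∀ i → ¬ (c i ≅ c (suc i))
    noEdgeRep : ∀ i → ¬ (c i ≅ c (suc (suc i)))

-- Elementary homotopies of closed walks (lists of representatives) in the
-- 2-complex obtained from Γ(Q) by attaching a 2-cell along every cycle of
-- length ≤ L.  A closed walk is paved iff it is connected to the trivial
-- walk by the equivalence closure of these moves.
data HStep {n : ℕ} (Q : Mat n) (L : ℕ) : List (Mat n) → List (Mat n) → Set where
  rep  : ∀ {xs ys} → Pointwise _≅_ xs ys → HStep Q L xs ys
  back : ∀ xs u v ys → InΓ Q v → Adj u v →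
         HStep Q L (xs ++ u ∷ ys) (xs ++ u ∷ v ∷ u ∷ ys)
  cell : ∀ xs u ys ℓ c → ℓ ≤ L → IsCycle Q ℓ c → c 0 ≡ u →
         HStep Q L (xs ++ u ∷ ys)
                   (xs ++ u ∷ (map c (drop 1 (upTo ℓ)) ++ u ∷ ys))

-- The closed walk w based at Q (given as the list Q, …, Q′ with Q′ ≅ Q)
-- is paved by cycles of Γ(Q) of length ≤ L.
PavedBy : ∀ {n} → Mat n → ℕ → List (Mat n) → Set
PavedBy Q L w = EqClosure (HStep Q L) w (Q ∷ [])

alt21 : ∀ {p} → ℕ → List (Fin (suc (suc p)))
alt21 k = concat (replicate k (suc zero ∷ zero ∷ []))

alt12 : ∀ {p} → ℕ → List (Fin (suc (suc p)))
alt12 k = concat (replicate k (zero ∷ suc zero ∷ []))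

downFrom : ∀ p → List (Fin (suc p))
downFrom p = reverse (map inject₁ (allFin p))

{-# OPTIONS --safe #-}
-- At Q, and at every quiver reached from Q by n, 1, 2, …, 1, 2 or by 1, 2, …, 1, 2 other than the
-- last one, each mutation leaving this path of 4k + 1 edges yields a fork in Warkentin's sense.
-- Mutating a fork anywhere but at its point of return gives a fork again, and forks have no source
-- or sink, while Q has one; so a reduced closed walk through Q never meets a fork and has to run
-- along the path in both directions. If its length were at most 4k + 1, two quivers of the path
-- would be isomorphic of which exactly one has a source or a sink.
-- Consequently no 2-cell touches the class of Q, and the parity of the number of traversals of the
-- edge between Q and its mutation N at n is a homotopy invariant. The given cycle traverses that
-- edge once: of its other edges only those of the sink mutations at n - 1, …, 3 join two quivers
-- having a source or a sink. If n ≥ 5, these have two vertices lying on no oriented triangle, and Q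
-- only one; if n = 4, weights are compared, and an isomorphism matching R and N would give
-- b_14(Q) = b_23(R).
module Submission where

open import Defs

-- Mutations alternating between 1 and 2 act on the weights between this pair and a third vertex by
-- the recurrence `w (t + 2) = a * w (t + 1) - w t`, where `a` is the multiplicity of `1 → 2`. The
-- word that builds `Q` from `R̃` winds up the weights at 3, ..., n - 1; both paths from `Q` unwind
-- these and wind up those at n instead. As `a` is at least 2, the sequences grow strictly from
-- index 1 on, and this growth supplies the inequalities that fork conditions ask for. Fork
-- conditions are delicate only where a path through the mutated vertex runs against an existing
-- arrow; there the opposing multiplicity must be bounded by one of the two arrows of the path. The
-- first two steps from `Q` at 1 and 2 also create arrows from 3, ..., n - 1 to n. The mutation
-- cycle closes because the way back from `R` creates equally many, by a Wronskian identity for two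
-- solutions of the recurrence.

module Quivers where

  open import Data.Bool.Base using (Bool; true; false; not; if_then_else_)
  open import Data.Bool.Properties using (not-involutive)
  open import Data.Empty using (⊥)
  open import Data.Fin.Base as Fin using (Fin; zero; suc; toℕ; inject₁; fromℕ)
  open import Data.Fin.Permutation as Perm using (Permutation′; _⟨$⟩ʳ_; _⟨$⟩ˡ_)
  open import Data.Fin.Properties using (_≟_; <-cmp; toℕ<n; toℕ-injective; ≤fromℕ;
    suc-injective; fromℕ≢inject₁; inject₁-injective)
  open import Data.Fin.Relation.Unary.Top using (view; ‵fromℕ; ‵inj₁)
  open import Data.Integer.Base as ℤ using (ℤ; +_; -[1+_]; _+_; _*_; _-_; -_; _≤_; _<_)
  open import Data.Integer.DivMod using (_/ℕ_)
  open import Data.Integer.Properties hiding (_≟_; <-cmp)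
  open import Data.Integer.Tactic.RingSolver using (solve-∀)
  open import Data.List.Base using (List; []; _∷_; _++_; map; drop; upTo; reverse; tabulate)
  open import Data.List.Properties using (unfold-reverse; map-tabulate; ++-assoc)
  open import Data.List.Relation.Binary.Pointwise using (Pointwise; []; _∷_)
  open import Data.List.Relation.Unary.All as All using (All; []; _∷_)
  open import Data.List.Relation.Unary.All.Properties using (map⁺)
  open import Data.Nat.Base as ℕ using (ℕ; zero; suc; z≤n; s≤s)
  import Data.Nat.DivMod as ℕ
  import Data.Nat.Properties as ℕ
  import Data.Nat.Tactic.RingSolver as ℕSolver
  open import Data.Product using (∃; _×_; _,_; proj₁; proj₂)
  open import Data.Sum using (_⊎_; inj₁; inj₂; swap)
  open import Function using (_∘_)
  import Relation.Binary.Construct.Closure.Equivalence as Eq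
  open import Relation.Binary.Construct.Closure.ReflexiveTransitive using (ε; _◅_; _◅◅_)
  open import Relation.Binary.Construct.Closure.Symmetric using (fwd; bwd)
  open import Relation.Binary.Definitions using (tri<; tri≈; tri>)
  open import Relation.Binary.PropositionalEquality
  open import Relation.Nullary using (¬_; yes; no; does; contradiction)
  open import Relation.Nullary.Decidable using (dec-true; dec-false; toSum)

  private variable m n : ℕ

  -- Integers

  0≤2 : + 0 ≤ + 2
  0≤2 = ℤ.+≤+ ℕ.z≤n

  2≤⇒0≤ : ∀ {x} → + 2 ≤ x → + 0 ≤ x
  2≤⇒0≤ = ≤-trans 0≤2

  0≤-sub : ∀ {x y} → x ≤ y → + 0 ≤ y - x
  0≤-sub = i≤j⇒0≤j-i

  0≤-+ : ∀ {x y} → + 0 ≤ x → + 0 ≤ y → + 0 ≤ x + y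
  0≤-+ p q = +-mono-≤ p q

  0≤-* : ∀ {x y} → + 0 ≤ x → + 0 ≤ y → + 0 ≤ x * y
  0≤-* {x} {y} p q with x | y | p | q
  ... | + m | + n | _ | _ rewrite sym (pos-* m n) = ℤ.+≤+ ℕ.z≤n

  -- The polynomial estimates below have this form: the difference is written as a sum of products
  -- of nonnegative terms, an identity left to the ring solver.
  excess : ∀ {x y} e → + 0 ≤ e → y ≡ x + e → x ≤ y
  excess {x} e p refl = ≤-trans (≤-reflexive (sym (+-identityʳ x))) (+-monoʳ-≤ x p)

  1+≤⇒< : ∀ {x y} → + 1 + x ≤ y → x < y
  1+≤⇒< = suc[i]≤j⇒i<j

  <⇒1+≤ : ∀ {x y} → x < y → + 1 + x ≤ y
  <⇒1+≤ = i<j⇒suc[i]≤j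

  2≤-asym : ∀ {x y} → x ≡ - y → + 2 ≤ x → ¬ (+ 2 ≤ y)
  2≤-asym refl p q with ≤-trans p (neg-mono-≤ q)
  ... | ()

  -- Mutation at w turns b_ab = z into z + x y if there is a path a → w → b with b_aw = x and b_wb = y.
  Dominates : ℤ → ℤ → ℤ → Set
  Dominates x y z = (x < z + x * y) × (y < z + x * y)

  dominates-swap : ∀ {x y z} → Dominates x y z → Dominates y x z
  dominates-swap {x} {y} {z} (p , q) rewrite *-comm x y = q , p

  dominates-nonneg : ∀ {x y z} → + 2 ≤ x → + 2 ≤ y → + 0 ≤ z → Dominates x y z
  dominates-nonneg {x} {y} {z} 2≤x 2≤y 0≤z = half 2≤x 2≤y 0≤z ,
      subst (λ e → y < z + e) (*-comm y x) (half 2≤y 2≤x 0≤z)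
    where
    identity : ∀ x y z → z + x * y ≡
      + 1 + x + (z + ((x - + 2) * (y - + 2) + ((x - + 2) + ((y - + 2) + ((y - + 2) + + 1)))))
    identity = solve-∀
    half : ∀ {x y z} → + 2 ≤ x → + 2 ≤ y → + 0 ≤ z → x < z + x * y
    half {x} {y} {z} p q r = 1+≤⇒< (excess _ pos (identity x y z))
      where
      X = 0≤-sub p
      Y = 0≤-sub q
      pos = 0≤-+ r (0≤-+ (0≤-* X Y) (0≤-+ X (0≤-+ Y (0≤-+ Y (ℤ.+≤+ ℕ.z≤n)))))

  -- Bounding `a` by one factor is enough: `x * y - a` exceeds `(x - 1) * y`, which is at least `y`,
  -- and at least `2 * (x - 1)`, hence at least `x`.
  dominates-neg : ∀ {x y a} → + 2 ≤ x → + 2 ≤ y → a < y → Dominates x y (- a)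
  dominates-neg {x} {y} {a} p q r =
      1+≤⇒< (excess _ (0≤-+ (0≤-* X Y) (0≤-+ X (0≤-+ Y A))) (id₁ x y a)) ,
      1+≤⇒< (excess _ (0≤-+ (0≤-* X Y) (0≤-+ X (0≤-+ X A))) (id₂ x y a))
    where
    X = 0≤-sub p
    Y = 0≤-sub q
    A = 0≤-sub (<⇒1+≤ r)
    id₁ : ∀ x y a → - a + x * y ≡
      + 1 + x + ((x - + 2) * (y - + 2) + ((x - + 2) + ((y - + 2) + (y - (+ 1 + a)))))
    id₁ = solve-∀
    id₂ : ∀ x y a → - a + x * y ≡
      + 1 + y + ((x - + 2) * (y - + 2) + ((x - + 2) + ((x - + 2) + (y - (+ 1 + a)))))
    id₂ = solve-∀

  -- The weights of the arrows between a third vertex and the pair 1 ⇉ 2 (of multiplicity a)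
  -- under the alternating mutations at 1 and 2.
  W : ℤ → ℤ → ℤ → ℕ → ℤ
  W a x y zero          = - x
  W a x y (suc zero)    = y
  W a x y (suc (suc t)) = a * W a x y (suc t) - W a x y t

  module _ {a x y} (2≤a : + 2 ≤ a) (2≤x : + 2 ≤ x) (2≤y : + 2 ≤ y) where

    private
      A = 0≤-sub 2≤a
      X = 0≤-sub 2≤x
      Y = 0≤-sub 2≤y

      id₀ : ∀ a x y → a * y - (- x) ≡ + 1 + y +
        ((a - + 2) * (y - + 2) + ((a - + 2) + ((a - + 2) + ((y - + 2) + ((x - + 2) + + 3)))))
      id₀ = solve-∀
      id₁ : ∀ a u v → a * v - u ≡ + 1 + v + ((a - + 2) * v + (v - (+ 1 + u)))
      id₁ = solve-∀
      id₂ : ∀ a x y → a * y - (- x) ≡ + 1 + a +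
        ((a - + 2) * (y - + 2) + ((y - + 2) + ((y - + 2) + ((a - + 2) + ((x - + 2) + + 3)))))
      id₂ = solve-∀

      0≤3 : + 0 ≤ + 3
      0≤3 = ℤ.+≤+ ℕ.z≤n

      -- Growth can start only at index 1, since the term at 0 is negative. From there on `a ≥ 2`
      -- keeps the differences of consecutive terms from decreasing.
      grows : ∀ t → (+ 2 ≤ W a x y (suc t)) × (W a x y (suc t) < W a x y (suc (suc t)))
      grows zero = 2≤y , 1+≤⇒< (excess _
        (0≤-+ (0≤-* A Y) (0≤-+ A (0≤-+ A (0≤-+ Y (0≤-+ X 0≤3))))) (id₀ a x y))
      grows (suc t) with grows t
      ... | 2≤u , u<v = 2≤v , 1+≤⇒< (excess _
              (0≤-+ (0≤-* A (2≤⇒0≤ 2≤v)) (0≤-sub (<⇒1+≤ u<v)))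
              (id₁ a (W a x y (suc t)) (W a x y (suc (suc t)))))
        where 2≤v = ≤-trans 2≤u (<⇒≤ u<v)

    2≤W : ∀ t → + 2 ≤ W a x y (suc t)
    2≤W t = proj₁ (grows t)

    W-mono-< : ∀ t → W a x y (suc t) < W a x y (suc (suc t))
    W-mono-< t = proj₂ (grows t)

    a<W : ∀ t → a < W a x y (suc (suc t))
    a<W zero    = 1+≤⇒< (excess _
      (0≤-+ (0≤-* A Y) (0≤-+ Y (0≤-+ Y (0≤-+ A (0≤-+ X 0≤3))))) (id₂ a x y))
    a<W (suc t) = <-trans (a<W t) (W-mono-< (suc t))

  -- The recurrence is its own reverse: read backwards, the rule that raises the index lowers it.
  W-back : ∀ a u v → a * v - (a * v - u) ≡ u
  W-back = solve-∀

  -- A discrete Wronskian: for two solutions of the same recurrence this bilinear expression depends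
  -- only on the sum of the two indices.
  W-cross : ∀ a {x y x′ y′} d t → let V = W a x y ; V′ = W a x′ y′ in
    V (suc d) * V′ (suc (suc t)) - V d * V′ (suc t) ≡
    V (suc (suc d)) * V′ (suc t) - V (suc d) * V′ t
  W-cross a {x} {y} {x′} {y′} d t =
    identity a (W a x y d) (W a x y (suc d)) (W a x′ y′ t) (W a x′ y′ (suc t))
    where
    identity : ∀ a u v r s → v * (a * s - r) - u * s ≡ (a * v - u) * s - v * r
    identity = solve-∀

  -- The whole index is moved from one sequence to the other. This makes the two sides of the
  -- mutation cycle agree on the arrows from `mid i` to n.
  W-cross-swap : ∀ a {x y x′ y′} t → let V = W a x y ; V′ = W a x′ y′ in
    V 1 * V′ (suc t) - V 0 * V′ t ≡ V (suc t) * V′ 1 - V t * V′ 0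
  W-cross-swap a {x} {y} {x′} {y′} t = go 0 t t refl
    where
    V = W a x y
    V′ = W a x′ y′
    go : ∀ d t s → d ℕ.+ t ≡ s →
         V (suc d) * V′ (suc t) - V d * V′ t ≡ V (suc s) * V′ 1 - V s * V′ 0
    go d zero    s eq rewrite ℕ.+-identityʳ d | eq = refl
    go d (suc t) s eq = trans (W-cross a {x} {y} {x′} {y′} d t) (go (suc d) t s (trans (sym (ℕ.+-suc d t)) eq))

  -- Mutation and isomorphism

  *2/2 : ∀ z → (z * + 2) /ℕ 2 ≡ z
  *2/2 (+ m) rewrite sym (pos-* m 2) = cong +_ (ℕ.m*n/n≡m m 2)
  *2/2 -[1+ m ] rewrite ℕ.m*n%n≡0 (suc m) 2 {{_}} | ℕ.m*n/n≡m (suc m) 2 {{_}} = refl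

  -- The correction term of `μ`. The number halved is twice `x * y`, twice its negative, or 0, so
  -- the division is exact.
  flow : ℤ → ℤ → ℤ
  flow x y = (abs x * y + x * abs y) /ℕ 2

  abs-nonneg : ∀ {x} → + 0 ≤ x → abs x ≡ x
  abs-nonneg = 0≤i⇒+∣i∣≡i

  abs-nonpos : ∀ {x} → x ≤ + 0 → abs x ≡ - x
  abs-nonpos {x} p = trans (cong +_ (sym (∣-i∣≡∣i∣ x))) (0≤i⇒+∣i∣≡i (neg-mono-≤ p))

  flow-abs : ∀ {x y u v} z → abs x ≡ u → abs y ≡ v → u * y + x * v ≡ z → flow x y ≡ z /ℕ 2
  flow-abs {x} {y} z p q r = cong (_/ℕ 2) (trans (cong₂ (λ u v → u * y + x * v) p q) r)

  flow-++ : ∀ {x y} → + 0 ≤ x → + 0 ≤ y → flow x y ≡ x * y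
  flow-++ {x} {y} p q =
    trans (flow-abs {x} {y} (x * y * + 2) (abs-nonneg p) (abs-nonneg q) (lemma x y)) (*2/2 (x * y))
    where
    lemma : ∀ x y → x * y + x * y ≡ x * y * + 2
    lemma = solve-∀

  flow--- : ∀ {x y} → x ≤ + 0 → y ≤ + 0 → flow x y ≡ - (x * y)
  flow--- {x} {y} p q =
    trans (flow-abs {x} {y} ((- (x * y)) * + 2) (abs-nonpos p) (abs-nonpos q) (lemma x y)) (*2/2 ((- (x * y))))
    where
    lemma : ∀ x y → (- x) * y + x * (- y) ≡ (- (x * y)) * + 2
    lemma = solve-∀

  flow-+- : ∀ {x y} → + 0 ≤ x → y ≤ + 0 → flow x y ≡ + 0
  flow-+- {x} {y} p q = flow-abs {x} {y} (+ 0) (abs-nonneg p) (abs-nonpos q) (lemma x y)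
    where
    lemma : ∀ x y → x * y + x * (- y) ≡ + 0
    lemma = solve-∀

  flow--+ : ∀ {x y} → x ≤ + 0 → + 0 ≤ y → flow x y ≡ + 0
  flow--+ {x} {y} p q = flow-abs {x} {y} (+ 0) (abs-nonpos p) (abs-nonneg q) (lemma x y)
    where
    lemma : ∀ x y → (- x) * y + x * y ≡ + 0
    lemma = solve-∀

  0≤neg : ∀ {x} → x ≤ + 0 → + 0 ≤ - x
  0≤neg = neg-mono-≤

  neg≤0 : ∀ {x} → + 0 ≤ x → - x ≤ + 0
  neg≤0 = neg-mono-≤

  flow-neg : ∀ x y → flow (- x) (- y) ≡ - flow x y
  flow-neg x y with ≤-total (+ 0) x | ≤-total (+ 0) y
  ... | inj₁ p | inj₁ q = trans (flow--- (neg≤0 p) (neg≤0 q))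
          (trans (lemma x y) (cong -_ (sym (flow-++ p q))))
    where
    lemma : ∀ x y → - ((- x) * (- y)) ≡ - (x * y)
    lemma = solve-∀
  ... | inj₁ p | inj₂ q = trans (flow--+ (neg≤0 p) (0≤neg q)) (cong -_ (sym (flow-+- p q)))
  ... | inj₂ p | inj₁ q = trans (flow-+- (0≤neg p) (neg≤0 q)) (cong -_ (sym (flow--+ p q)))
  ... | inj₂ p | inj₂ q = trans (flow-++ (0≤neg p) (0≤neg q))
          (trans (lemma x y) (cong -_ (sym (flow--- p q))))
    where
    lemma : ∀ x y → (- x) * (- y) ≡ - (- (x * y))
    lemma = solve-∀

  flow-comm : ∀ x y → flow x y ≡ flow y x
  flow-comm x y = cong (_/ℕ 2) (lemma (abs x) y x (abs y))
    where
    lemma : ∀ a y x b → a * y + x * b ≡ b * x + y * a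
    lemma = solve-∀

  μ-source : ∀ (k : Fin n) B j → μ k B k j ≡ - B k j
  μ-source k B j with k ≟ k | j ≟ k
  ... | yes _ | _ = refl
  ... | no ne | _ = contradiction refl ne

  μ-target : ∀ (k : Fin n) B i → μ k B i k ≡ - B i k
  μ-target k B i with i ≟ k | k ≟ k
  ... | yes _ | _     = refl
  ... | no _  | yes _ = refl
  ... | no _  | no ne = contradiction refl ne

  μ-off : ∀ {k : Fin n} B {i j} → i ≢ k → j ≢ k → μ k B i j ≡ B i j + flow (B i k) (B k j)
  μ-off {k = k} B {i} {j} i≢k j≢k with i ≟ k | j ≟ k
  ... | yes p | _     = contradiction p i≢k
  ... | no _  | yes q = contradiction q j≢k
  ... | no _  | no _  = refl

  module _ {k : Fin n} (B : Mat n) {i j : Fin n} (i≢k : i ≢ k) (j≢k : j ≢ k) where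

    μ-++ : + 0 ≤ B i k → + 0 ≤ B k j → μ k B i j ≡ B i j + B i k * B k j
    μ-++ p q = trans (μ-off B i≢k j≢k) (cong (λ e → B i j + e) (flow-++ p q))

    μ-+- : + 0 ≤ B i k → B k j ≤ + 0 → μ k B i j ≡ B i j
    μ-+- p q = trans (μ-off B i≢k j≢k) (trans (cong (λ e → B i j + e) (flow-+- p q)) (+-identityʳ _))

    μ--+ : B i k ≤ + 0 → + 0 ≤ B k j → μ k B i j ≡ B i j
    μ--+ p q = trans (μ-off B i≢k j≢k) (trans (cong (λ e → B i j + e) (flow--+ p q)) (+-identityʳ _))

  μ-quiver : ∀ (k : Fin n) {B} → IsQuiver B → IsQuiver (μ k B)
  μ-quiver k {B} quiv i j with i ≟ k | j ≟ k
  ... | yes _ | yes _ = cong -_ (quiv i j)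
  ... | yes _ | no _  = cong -_ (quiv i j)
  ... | no _  | yes _ = cong -_ (quiv i j)
  ... | no _  | no _  = begin
      B i j + flow (B i k) (B k j)            ≡⟨ cong₂ _+_ (quiv i j) step ⟩
      - B j i + - flow (B j k) (B k i)        ≡⟨ sym (neg-distrib-+ (B j i) _) ⟩
      - (B j i + flow (B j k) (B k i))        ∎
    where
    open ≡-Reasoning
    step : flow (B i k) (B k j) ≡ - flow (B j k) (B k i)
    step = begin
      flow (B i k) (B k j)         ≡⟨ cong₂ flow (quiv i k) (quiv k j) ⟩
      flow (- B k i) (- B j k)     ≡⟨ flow-neg (B k i) (B j k) ⟩
      - flow (B k i) (B j k)       ≡⟨ cong -_ (flow-comm (B k i) (B j k)) ⟩
      - flow (B j k) (B k i)       ∎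

  μs-quiver : ∀ (ks : List (Fin n)) {B} → IsQuiver B → IsQuiver (μs ks B)
  μs-quiver []       quiv = quiv
  μs-quiver (k ∷ ks) quiv = μs-quiver ks (μ-quiver k quiv)

  μ-cong : ∀ (k : Fin n) {A B} → A ≋ B → μ k A ≋ μ k B
  μ-cong k {A} {B} eq i j with i ≟ k | j ≟ k
  ... | yes _ | _     = cong -_ (eq i j)
  ... | no _  | yes _ = cong -_ (eq i j)
  ... | no _  | no _  = cong₂ _+_ (eq i j) (cong₂ flow (eq i k) (eq k j))

  μs-++ : ∀ (ks ls : List (Fin n)) B → μs (ks ++ ls) B ≡ μs ls (μs ks B)
  μs-++ []       ls B = refl
  μs-++ (k ∷ ks) ls B = μs-++ ks ls (μ k B)

  -- The entries at `k` change sign, and `flow` changes sign with both its arguments, so the second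
  -- correction cancels the first.
  μ-involutive : ∀ (k : Fin n) B → μ k (μ k B) ≋ B
  μ-involutive k B i j with i ≟ k
  ... | yes refl = trans (cong -_ (μ-source k B j)) (neg-involutive (B k j))
  ... | no i≢k with j ≟ k
  ...   | yes refl = trans (cong -_ (μ-target k B i)) (neg-involutive (B i k))
  ...   | no j≢k = begin
      μ k B i j + flow (μ k B i k) (μ k B k j)
        ≡⟨ cong₂ _+_ (μ-off B i≢k j≢k) (cong₂ flow (μ-target k B i) (μ-source k B j)) ⟩
      B i j + flow (B i k) (B k j) + flow (- B i k) (- B k j)
        ≡⟨ cong (λ e → B i j + flow (B i k) (B k j) + e) (flow-neg (B i k) (B k j)) ⟩
      B i j + flow (B i k) (B k j) + - flow (B i k) (B k j)
        ≡⟨ cancel (B i j) _ ⟩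
      B i j ∎
    where
    open ≡-Reasoning
    cancel : ∀ x y → x + y + - y ≡ x
    cancel = solve-∀

  ≋-sym : ∀ {A B : Mat n} → A ≋ B → B ≋ A
  ≋-sym eq i j = sym (eq i j)

  ≋-trans : ∀ {A B C : Mat n} → A ≋ B → B ≋ C → A ≋ C
  ≋-trans eq eq′ i j = trans (eq i j) (eq′ i j)

  -- Isomorphisms up to a global sign

  data Sgn : Set where
    pos neg : Sgn

  _·_ : Sgn → ℤ → ℤ
  pos · x = x
  neg · x = - x

  _∙_ : Sgn → Sgn → Sgn
  pos ∙ t = t
  neg ∙ pos = neg
  neg ∙ neg = pos

  ∙-· : ∀ s t x → (s ∙ t) · x ≡ s · (t · x)
  ∙-· pos t   x = refl
  ∙-· neg pos x = refl
  ∙-· neg neg x = sym (neg-involutive x)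

  ·-involutive : ∀ s x → s · (s · x) ≡ x
  ·-involutive pos x = refl
  ·-involutive neg x = neg-involutive x

  ·-neg : ∀ s x → s · (- x) ≡ - (s · x)
  ·-neg pos x = refl
  ·-neg neg x = refl

  ·-+ : ∀ s x y → s · (x + y) ≡ s · x + s · y
  ·-+ pos x y = refl
  ·-+ neg x y = neg-distrib-+ x y

  ·-flow : ∀ s x y → flow (s · x) (s · y) ≡ s · flow x y
  ·-flow pos x y = refl
  ·-flow neg x y = flow-neg x y

  -- A normal form for the generated equivalence: reversal commutes with relabeling, so any chain of
  -- the two collapses to one permutation and one sign.
  record Iso {n} (A B : Mat n) : Set where
    constructor iso
    field
      σ   : Permutation′ n
      s   : Sgn
      eqn : ∀ i j → B i j ≡ s · A (σ ⟨$⟩ʳ i) (σ ⟨$⟩ʳ j)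

    σ-injective : ∀ {i j} → σ ⟨$⟩ʳ i ≡ σ ⟨$⟩ʳ j → i ≡ j
    σ-injective {i} {j} eq = trans (sym (Perm.inverseˡ σ)) (trans (cong (σ ⟨$⟩ˡ_) eq) (Perm.inverseˡ σ))

  ≋⇒Iso : ∀ {A B : Mat n} → A ≋ B → Iso A B
  ≋⇒Iso eq = iso Perm.id pos (λ i j → sym (eq i j))

  Iso-refl : ∀ {A : Mat n} → Iso A A
  Iso-refl = ≋⇒Iso (λ _ _ → refl)

  Iso-trans : ∀ {A B C : Mat n} → Iso A B → Iso B C → Iso A C
  Iso-trans (iso σ s eq) (iso τ t eq′) = iso (τ Perm.∘ₚ σ) (t ∙ s)
    λ i j → trans (eq′ i j) (trans (cong (t ·_) (eq _ _)) (sym (∙-· t s _)))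

  Iso-sym : ∀ {A B : Mat n} → Iso A B → Iso B A
  Iso-sym {A = A} (iso σ s eq) = iso (Perm.flip σ) s
    λ i j → trans (sym (·-involutive s _)) (cong (s ·_)
      (sym (trans (eq _ _) (cong₂ (λ x y → s · A x y) (Perm.inverseʳ σ) (Perm.inverseʳ σ)))))

  ≅⇒Iso : ∀ {A B : Mat n} → A ≅ B → Iso A B
  ≅⇒Iso = Eq.fold (record { refl = Iso-refl ; sym = Iso-sym ; trans = Iso-trans }) step
    where
    step : ∀ {A B : Mat n} → RelabelOrReverse A B → Iso A B
    step (relabel σ eq)     = iso σ pos eq
    step (reverseArrows eq) = iso Perm.id neg eq

  Iso⇒≅ : ∀ {A B : Mat n} → Iso A B → A ≅ B
  Iso⇒≅ (iso σ pos eq) = fwd (relabel σ eq) ◅ ε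
  Iso⇒≅ {A = A} (iso σ neg eq) =
    fwd (relabel {B = λ i j → A (σ ⟨$⟩ʳ i) (σ ⟨$⟩ʳ j)} σ λ _ _ → refl) ◅ fwd (reverseArrows eq) ◅ ε

  ≅-sym : ∀ {A B : Mat n} → A ≅ B → B ≅ A
  ≅-sym = Eq.symmetric _

  ≋⇒≅ : ∀ {A B : Mat n} → A ≋ B → A ≅ B
  ≋⇒≅ eq = Iso⇒≅ (≋⇒Iso eq)

  -- Reversal is compatible with mutation because `flow` changes sign with both arguments. Hence the
  -- edges of Γ can be followed from any representative.
  Iso-μ : ∀ {A B : Mat n} (φ : Iso A B) k → Iso (μ (Iso.σ φ ⟨$⟩ʳ k) A) (μ k B)
  Iso-μ {A = A} {B} φ@(iso σ s eq) k = iso σ s eqn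
    where
    eqn : ∀ i j → μ k B i j ≡ s · μ (σ ⟨$⟩ʳ k) A (σ ⟨$⟩ʳ i) (σ ⟨$⟩ʳ j)
    eqn i j with i ≟ k
    ... | yes refl = trans (cong -_ (eq k j)) (trans (sym (·-neg s _)) (cong (s ·_) (sym (μ-source _ A _))))
    ... | no i≢k with j ≟ k
    ...   | yes refl = trans (cong -_ (eq i k)) (trans (sym (·-neg s _)) (cong (s ·_) (sym (μ-target _ A _))))
    ...   | no j≢k = begin
        B i j + flow (B i k) (B k j)
          ≡⟨ cong₂ _+_ (eq i j) (trans (cong₂ flow (eq i k) (eq k j)) (·-flow s (A i′ k′) (A k′ j′))) ⟩
        s · A i′ j′ + s · flow (A i′ k′) (A k′ j′)
          ≡⟨ sym (·-+ s (A i′ j′) (flow (A i′ k′) (A k′ j′))) ⟩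
        s · (A i′ j′ + flow (A i′ k′) (A k′ j′))
          ≡⟨ cong (s ·_) (sym (μ-off A (λ e → i≢k (Iso.σ-injective φ e)) (λ e → j≢k (Iso.σ-injective φ e)))) ⟩
        s · μ k′ A i′ j′ ∎
      where
      open ≡-Reasoning
      i′ = σ ⟨$⟩ʳ i
      j′ = σ ⟨$⟩ʳ j
      k′ = σ ⟨$⟩ʳ k

  Iso-quiver : ∀ {A B : Mat n} → Iso A B → IsQuiver A → IsQuiver B
  Iso-quiver {B = B} (iso σ s eq) quiv i j =
    trans (eq i j) (trans (cong (s ·_) (quiv _ _)) (trans (·-neg s _) (cong -_ (sym (eq j i)))))

  -- Forks and reduced walks

  -- In an abundant quiver every arrow is at least double, so b_ij ≥ 2 just says i → j.
  Arr : Mat n → Fin n → Fin n → Set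
  Arr B i j = + 2 ≤ B i j

  Abundant : Mat n → Set
  Abundant B = ∀ i j → i ≢ j → Arr B i j ⊎ Arr B j i

  NoSourceSink : Mat n → Set
  NoSourceSink B = ∀ v → (∃ λ a → Arr B a v) × (∃ λ b → Arr B v b)

  OnTriangle : Mat n → Fin n → Set
  OnTriangle B v = ∃ λ x → ∃ λ y → Arr B v x × Arr B x y × Arr B y v

  module _ {B : Mat n} (quiv : IsQuiver B) where

    Arr-asym : ∀ {i j} → Arr B i j → ¬ Arr B j i
    Arr-asym {i} {j} = 2≤-asym (quiv i j)

    Arr-irrefl : ∀ {i} → ¬ Arr B i i
    Arr-irrefl p = Arr-asym p p

    Arr⇒≢ : ∀ {i j} → Arr B i j → i ≢ j
    Arr⇒≢ p refl = Arr-irrefl p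

    Arr⇒nonpos : ∀ {i j} → Arr B i j → B j i ≤ + 0
    Arr⇒nonpos {i} {j} p = ≤-trans (≤-reflexive (quiv j i)) (neg≤0 (2≤⇒0≤ p))

  -- Warkentin's forks with point of return r: every cycle passes through r, and the arrow closing
  -- a cyclic triangle through r dominates.
  record Fork (B : Mat n) (r : Fin n) : Set where
    field
      quiv     : IsQuiver B
      abundant : Abundant B
      acyclic  : ∀ {a b c} → a ≢ r → b ≢ r → c ≢ r → Arr B a b → Arr B b c → Arr B a c
      return   : ∀ {i j} → Arr B i r → Arr B r j → (B i r < B j i) × (B r j < B j i)
      inner    : ∃ λ i → Arr B i r
      outer    : ∃ λ j → Arr B r j

    return-Arr : ∀ {i j} → Arr B i r → Arr B r j → Arr B j i
    return-Arr p q = ≤-trans p (<⇒≤ (proj₁ (return p q)))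

    -- Each vertex other than `r` lies on an oriented triangle with `r`, closed by an arrow that
    -- `return` provides.
    noSourceSink : NoSourceSink B
    noSourceSink v with v ≟ r
    ... | yes refl = inner , outer
    ... | no v≢r with abundant v r v≢r
    ...   | inj₁ v→r = (proj₁ outer , return-Arr v→r (proj₂ outer)) , (r , v→r)
    ...   | inj₂ r→v = (r , r→v) , (proj₁ inner , return-Arr (proj₂ inner) r→v)

  module _ {B : Mat n} (w : Fin n) (quiv : IsQuiver B) (abundant : Abundant B)
    (trans-in  : ∀ {a b c} → Arr B a w → Arr B b w → Arr B c w → Arr B a b → Arr B b c → Arr B a c)
    (trans-out : ∀ {a b c} → Arr B w a → Arr B w b → Arr B w c → Arr B a b → Arr B b c → Arr B a c)
    (dominates : ∀ {a b} → Arr B a w → Arr B w b → Dominates (B a w) (B w b) (B a b))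
    (inner : ∃ λ a → Arr B a w) (outer : ∃ λ b → Arr B w b) where

    private
      B′ = μ w B

      quiv′ : IsQuiver B′
      quiv′ = μ-quiver w quiv

      in-in : ∀ {i j} → Arr B i w → Arr B j w → B′ i j ≡ B i j
      in-in p q = μ-+- B (Arr⇒≢ quiv p) (Arr⇒≢ quiv q) (2≤⇒0≤ p) (Arr⇒nonpos quiv q)

      out-out : ∀ {i j} → Arr B w i → Arr B w j → B′ i j ≡ B i j
      out-out p q = μ--+ B (Arr⇒≢ quiv p ∘ sym) (Arr⇒≢ quiv q ∘ sym) (Arr⇒nonpos quiv p) (2≤⇒0≤ q)

      in-out : ∀ {i j} → Arr B i w → Arr B w j → B′ i j ≡ B i j + B i w * B w j
      in-out p q = μ-++ B (Arr⇒≢ quiv p) (Arr⇒≢ quiv q ∘ sym) (2≤⇒0≤ p) (2≤⇒0≤ q)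

      at-source : ∀ j → B′ w j ≡ B j w
      at-source j = trans (μ-source w B j) (sym (quiv j w))

      at-target : ∀ i → B′ i w ≡ B w i
      at-target i = trans (μ-target w B i) (sym (quiv w i))

      in-out-Arr : ∀ {i j} → Arr B i w → Arr B w j → Arr B′ i j
      in-out-Arr p q rewrite in-out p q = ≤-trans p (<⇒≤ (proj₁ (dominates p q)))

      side : ∀ {i} → i ≢ w → Arr B i w ⊎ Arr B w i
      side {i} i≢w = abundant i w i≢w

      abundant′ : Abundant B′
      abundant′ i j i≢j with toSum (i ≟ w) | toSum (j ≟ w)
      ... | inj₁ refl | inj₁ refl = contradiction refl i≢j
      ... | inj₁ refl | inj₂ j≢w rewrite at-source j | at-target j = side j≢w
      ... | inj₂ i≢w | inj₁ refl rewrite at-source i | at-target i = swap (side i≢w)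
      ... | inj₂ i≢w | inj₂ j≢w with side i≢w | side j≢w
      ...   | inj₁ p | inj₁ q rewrite in-in p q | in-in q p = abundant i j i≢j
      ...   | inj₁ p | inj₂ q = inj₁ (in-out-Arr p q)
      ...   | inj₂ p | inj₁ q = inj₂ (in-out-Arr q p)
      ...   | inj₂ p | inj₂ q rewrite out-out p q | out-out q p = abundant i j i≢j

      acyclic′ : ∀ {a b c} → a ≢ w → b ≢ w → c ≢ w → Arr B′ a b → Arr B′ b c → Arr B′ a c
      acyclic′ {a} {b} {c} a≢w b≢w c≢w a→b b→c with side a≢w | side b≢w | side c≢w
      ... | inj₁ p | inj₁ q | inj₁ r rewrite in-in p q | in-in q r | in-in p r = trans-in p q r a→b b→c
      ... | inj₂ p | inj₂ q | inj₂ r rewrite out-out p q | out-out q r | out-out p r = trans-out p q r a→b b→c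
      ... | inj₁ p | _      | inj₂ r = in-out-Arr p r
      ... | inj₂ p | inj₁ q | _      = contradiction (in-out-Arr {b} {a} q p) (Arr-asym quiv′ {a} {b} a→b)
      ... | _      | inj₂ q | inj₁ r = contradiction (in-out-Arr {c} {b} r q) (Arr-asym quiv′ {b} {c} b→c)

    -- Mutation at `w` keeps the arrows among its in-neighbours and among its out-neighbours and, by
    -- `dominates`, makes every former in-neighbour point to every former out-neighbour. So two
    -- transitive orders are stacked, and the reversed arrows at `w` close triangles with the
    -- dominating ones.
    mutate-fork : Fork (μ w B) w
    mutate-fork = record
      { quiv     = quiv′
      ; abundant = abundant′
      ; acyclic  = acyclic′
      ; return   = return′
      ; inner    = proj₁ outer , subst (+ 2 ≤_) (sym (at-target _)) (proj₂ outer)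
      ; outer    = proj₁ inner , subst (+ 2 ≤_) (sym (at-source _)) (proj₂ inner)
      }
      where
      return′ : ∀ {i j} → Arr B′ i w → Arr B′ w j → (B′ i w < B′ j i) × (B′ w j < B′ j i)
      return′ {i} {j} p q rewrite at-target i | at-source j | in-out q p = swap× (dominates q p)
        where
        swap× : ∀ {A B : Set} → A × B → B × A
        swap× (x , y) = y , x

  -- Warkentin's lemma. A path through `k` that avoids `r` is parallel to an arrow by acyclicity. If
  -- it starts or ends at `r`, an arrow opposing it is smaller than the arrow between `k` and the
  -- other end, by `return`.
  fork-mutate : ∀ {B : Mat n} {r} → Fork B r → ∀ k → k ≢ r → Fork (μ k B) k
  fork-mutate {n} {B} {r} F k k≢r = by-side (abundant k r k≢r)
    where
    open Fork F

    grow : ∀ {a b} → Arr B a k → Arr B k b → Arr B a b → Dominates (B a k) (B k b) (B a b)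
    grow p q s = dominates-nonneg p q (2≤⇒0≤ s)

    neg-entry : ∀ {a b} → Dominates (B a k) (B k b) (- B b a) → Dominates (B a k) (B k b) (B a b)
    neg-entry {a} {b} = subst (Dominates (B a k) (B k b)) (sym (quiv a b))

    by-side : Arr B k r ⊎ Arr B r k → Fork (μ k B) k
    by-side (inj₂ r→k) = mutate-fork k quiv abundant trans-in trans-out dominates
        (r , r→k) (proj₁ inner , return-Arr (proj₂ inner) r→k)
      where
      -- Thus `r`, itself an in-neighbour of `k`, is a source among the in-neighbours.
      not-into-r : ∀ {i} → Arr B i k → ¬ Arr B i r
      not-into-r i→k i→r = Arr-asym quiv i→k (return-Arr i→r r→k)

      trans-in : ∀ {a b c} → Arr B a k → Arr B b k → Arr B c k → Arr B a b → Arr B b c → Arr B a c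
      trans-in {a} {b} {c} p q s a→b b→c with a ≟ r | b ≟ r | c ≟ r
      ... | no a≢r | no b≢r | no c≢r = acyclic a≢r b≢r c≢r a→b b→c
      ... | _ | yes refl | _ = contradiction a→b (not-into-r p)
      ... | _ | _ | yes refl = contradiction b→c (not-into-r q)
      ... | yes refl | _ | no c≢r with abundant c r c≢r
      ...   | inj₁ c→r = contradiction c→r (not-into-r s)
      ...   | inj₂ r→c = r→c

      ≢r : ∀ {i} → Arr B k i → i ≢ r
      ≢r k→i refl = Arr-asym quiv k→i r→k

      trans-out : ∀ {a b c} → Arr B k a → Arr B k b → Arr B k c → Arr B a b → Arr B b c → Arr B a c
      trans-out p q s = acyclic (≢r p) (≢r q) (≢r s)

      dominates : ∀ {a b} → Arr B a k → Arr B k b → Dominates (B a k) (B k b) (B a b)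
      dominates {a} {b} a→k k→b with a ≟ r
      ... | no a≢r = grow a→k k→b (acyclic a≢r k≢r (≢r k→b) a→k k→b)
      ... | yes refl with abundant b r (≢r k→b)
      ...   | inj₁ b→r = neg-entry {a} {b} (dominates-neg a→k k→b (proj₁ (return b→r r→k)))
      ...   | inj₂ r→b = grow a→k k→b r→b
    by-side (inj₁ k→r) = mutate-fork k quiv abundant trans-in trans-out dominates
        (proj₁ outer , return-Arr k→r (proj₂ outer)) (r , k→r)
      where
      not-from-r : ∀ {i} → Arr B k i → ¬ Arr B r i
      not-from-r k→i r→i = Arr-asym quiv k→i (return-Arr k→r r→i)

      trans-out : ∀ {a b c} → Arr B k a → Arr B k b → Arr B k c → Arr B a b → Arr B b c → Arr B a c
      trans-out {a} {b} {c} p q s a→b b→c with a ≟ r | b ≟ r | c ≟ r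
      ... | no a≢r | no b≢r | no c≢r = acyclic a≢r b≢r c≢r a→b b→c
      ... | yes refl | _ | _ = contradiction a→b (not-from-r q)
      ... | _ | yes refl | _ = contradiction b→c (not-from-r s)
      ... | no a≢r | _ | yes refl with abundant a r a≢r
      ...   | inj₁ a→r = a→r
      ...   | inj₂ r→a = contradiction r→a (not-from-r p)

      ≢r : ∀ {i} → Arr B i k → i ≢ r
      ≢r i→k refl = Arr-asym quiv k→r i→k

      trans-in : ∀ {a b c} → Arr B a k → Arr B b k → Arr B c k → Arr B a b → Arr B b c → Arr B a c
      trans-in p q s = acyclic (≢r p) (≢r q) (≢r s)

      dominates : ∀ {a b} → Arr B a k → Arr B k b → Dominates (B a k) (B k b) (B a b)
      dominates {a} {b} a→k k→b with b ≟ r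
      ... | no b≢r = grow a→k k→b (acyclic (≢r a→k) k≢r b≢r a→k k→b)
      ... | yes refl with abundant a r (≢r a→k)
      ...   | inj₁ a→r = grow a→k k→b a→r
      ...   | inj₂ r→a = neg-entry {a} {b}
              (dominates-swap {B k b} {B a k} { - B b a} (dominates-neg k→b a→k (proj₂ (return k→r r→a))))

  -- Sources, sinks and triangles under isomorphism

  NoSourceSink-Iso : ∀ {A B : Mat n} → Iso A B → IsQuiver A → NoSourceSink A → NoSourceSink B
  NoSourceSink-Iso {A = A} {B} (iso σ s eq) quiv noSS v = go s eq (noSS (σ ⟨$⟩ʳ v))
    where
    pre = σ ⟨$⟩ˡ_
    eqʳ : ∀ {x} → σ ⟨$⟩ʳ (σ ⟨$⟩ˡ x) ≡ x
    eqʳ = Perm.inverseʳ σ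
    go : ∀ s → (∀ i j → B i j ≡ s · A (σ ⟨$⟩ʳ i) (σ ⟨$⟩ʳ j)) →
         (∃ λ a → Arr A a (σ ⟨$⟩ʳ v)) × (∃ λ b → Arr A (σ ⟨$⟩ʳ v) b) →
         (∃ λ a → Arr B a v) × (∃ λ b → Arr B v b)
    go pos eq ((a , p) , (b , q)) =
      (pre a , subst (+ 2 ≤_) (sym (trans (eq _ v) (cong (λ x → A x _) eqʳ))) p) ,
      (pre b , subst (+ 2 ≤_) (sym (trans (eq v _) (cong (λ x → A _ x) eqʳ))) q)
    go neg eq ((a , p) , (b , q)) =
      (pre b , subst (+ 2 ≤_) (sym (trans (eq _ v) (trans (sym (quiv _ _)) (cong (λ x → A _ x) eqʳ)))) q) ,
      (pre a , subst (+ 2 ≤_) (sym (trans (eq v _) (trans (sym (quiv _ _)) (cong (λ x → A x _) eqʳ)))) p)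

  OnTriangle-Iso : ∀ {A B : Mat n} (φ : Iso A B) → IsQuiver A → ∀ v →
    OnTriangle B v → OnTriangle A (Iso.σ φ ⟨$⟩ʳ v)
  OnTriangle-Iso (iso σ pos eq) quiv v (x , y , p , q , r) =
    σ ⟨$⟩ʳ x , σ ⟨$⟩ʳ y , subst (+ 2 ≤_) (eq _ _) p , subst (+ 2 ≤_) (eq _ _) q , subst (+ 2 ≤_) (eq _ _) r
  OnTriangle-Iso {A = A} (iso σ neg eq) quiv v (x , y , p , q , r) =
    σ ⟨$⟩ʳ y , σ ⟨$⟩ʳ x , flip r , flip q , flip p
    where
    flip : ∀ {i j} → + 2 ≤ _ → Arr A (σ ⟨$⟩ʳ j) (σ ⟨$⟩ʳ i)
    flip {i} {j} = subst (+ 2 ≤_) (trans (eq i j) (sym (quiv _ _)))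

  -- Closed reduced walks in Γ, in a form that is also satisfied by the reversed walk: instead of
  -- being periodic, the walk returns to the class of Q from every position.
  record ReducedWalk (Q : Mat n) (c : ℕ → Mat n) : Set where
    field
      adjacent : ∀ i {X} → IsQuiver X → Iso X (c i) → ∃ λ k → Iso (μ k X) (c (suc i))
      noBack   : ∀ i → ¬ Iso (c i) (c (suc (suc i)))
      recurs   : ∀ i → ∃ λ d → Iso (c (d ℕ.+ i)) Q

  module _ {Q : Mat n} {c : ℕ → Mat n} (walk : ReducedWalk Q c) (source-sink : ¬ NoSourceSink Q) where
    open ReducedWalk walk

    -- Invariant `stays`: every later class contains a fork whose point of return leads back to the
    -- previous class. Mutating there would be a step back, which `noBack` excludes.
    fork-leaves : ∀ i {X r} → Fork X r → Iso X (c (suc i)) → ¬ Iso (μ r X) (c i)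
    fork-leaves i {X} {r} F x x′ with recurs (suc i)
    ... | d , home with stays d
      where
      stays : ∀ d → ∃ λ Y → ∃ λ s → Fork Y s × Iso Y (c (d ℕ.+ suc i)) × Iso (μ s Y) (c (d ℕ.+ i))
      stays zero = X , r , F , x , x′
      stays (suc d) with stays d
      ... | Y , s , G , y , y′ with adjacent (d ℕ.+ suc i) (Fork.quiv G) y
      ...   | k , z with k ≟ s
      ...     | no k≢s = μ k Y , k , fork-mutate G k k≢s , z ,
                  Iso-trans (≋⇒Iso (μ-involutive k Y)) (subst (λ e → Iso Y (c e)) (ℕ.+-suc d i) y)
      ...     | yes refl = contradiction
                  (Iso-trans (Iso-sym y′) (subst (λ e → Iso (μ k Y) (c e)) (cong suc (ℕ.+-suc d i)) z))
                  (noBack (d ℕ.+ i))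
    ...   | Y , s , G , y , _ = source-sink
            (NoSourceSink-Iso (Iso-trans y home) (Fork.quiv G) (Fork.noSourceSink G))

    module _ (P : ℕ → Mat n) (e : ℕ → Fin n) (T : ℕ)
      (quiv : ∀ t → IsQuiver (P t))
      (step : ∀ t → P (suc t) ≡ μ (e t) (P t))
      (fork : ∀ t → suc t ℕ.< T → ∀ w → w ≢ e t → w ≢ e (suc t) → Fork (μ w (P (suc t))) w)
      (start₀ : Iso (P 0) (c 0)) (start₁ : Iso (P 1) (c 1)) where

      -- Besides the next direction of the path, the walk could only step back, against `noBack`, or
      -- enter a fork, against `fork-leaves`.
      follows-path : ∀ t → t ℕ.≤ T → Iso (P t) (c t)
      follows-path zero    _ = start₀
      follows-path (suc t) = both t
        where
        both : ∀ t → suc t ℕ.≤ T → Iso (P (suc t)) (c (suc t))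
        both zero    _ = start₁
        both (suc t) t< with both t (ℕ.≤-trans (ℕ.n≤1+n _) t<)
        ... | here with adjacent (suc t) (quiv (suc t)) here
        ...   | k , next with k ≟ e (suc t)
        ...     | yes refl = subst (λ X → Iso X (c _)) (sym (step (suc t))) next
        ...     | no k≢ with k ≟ e t
        ...       | no k≢′ = contradiction (Iso-trans (≋⇒Iso (μ-involutive k (P (suc t)))) here)
                      (fork-leaves (suc t) (fork t t< k k≢′ k≢) next)
        ...       | yes refl = contradiction
                      (Iso-trans (Iso-sym (follows-path t (ℕ.≤-trans (ℕ.n≤1+n _) (ℕ.≤-trans (ℕ.n≤1+n _) t<))))
                        (Iso-trans (≋⇒Iso (≋-sym undo)) next))
                      (noBack t)
          where
          undo : μ (e t) (P (suc t)) ≋ P t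
          undo rewrite step t = μ-involutive (e t) (P t)

  -- Quivers along the alternating mutations

  pattern v₁ = zero
  pattern v₂ = suc zero

  mid : Fin (suc m) → Fin (4 ℕ.+ m)
  mid i = suc (suc (inject₁ i))

  last : Fin (4 ℕ.+ m)
  last = fromℕ _

  data Roles {n} : Fin (2 ℕ.+ n) → Fin (2 ℕ.+ n) → Set where
    r₁₂ : Roles v₁ v₂
    r₂₁ : Roles v₂ v₁

  swapRoles : ∀ {p q : Fin (2 ℕ.+ n)} → Roles p q → Roles q p
  swapRoles r₁₂ = r₂₁
  swapRoles r₂₁ = r₁₂

  data Class (p q : Fin (4 ℕ.+ m)) : Fin (4 ℕ.+ m) → Set where
    isP    : Class p q p
    isQ    : Class p q q
    isMid  : ∀ i → Class p q (mid i)
    isLast : Class p q last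

  classify : ∀ {p q : Fin (4 ℕ.+ m)} → Roles p q → ∀ z → Class p q z
  classify r₁₂ v₁ = isP
  classify r₁₂ v₂ = isQ
  classify r₂₁ v₁ = isQ
  classify r₂₁ v₂ = isP
  classify r (suc (suc z)) with view z
  ... | ‵fromℕ        = isLast
  ... | ‵inj₁ {i = i} _ = isMid i

  module _ {p q : Fin (2 ℕ.+ n)} where

    P≢Q : Roles p q → p ≢ q
    P≢Q r₁₂ ()
    P≢Q r₂₁ ()

    other≢P : Roles p q → ∀ {z} → suc (suc z) ≢ p
    other≢P r₁₂ ()
    other≢P r₂₁ ()

    other≢Q : Roles p q → ∀ {z} → suc (suc z) ≢ q
    other≢Q r₁₂ ()
    other≢Q r₂₁ ()

  mid-injective : ∀ {i j : Fin (suc m)} → mid i ≡ mid j → i ≡ j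
  mid-injective = inject₁-injective ∘ suc-injective ∘ suc-injective

  mid≢last : ∀ {i : Fin (suc m)} → mid i ≢ last
  mid≢last eq = fromℕ≢inject₁ (sym (suc-injective (suc-injective eq)))

  diagonal-unique : ∀ {x y} → x ≡ - x → y ≡ - y → x ≡ y
  diagonal-unique p q = trans (zero-of p) (sym (zero-of q))
    where
    zero-of : ∀ {x} → x ≡ - x → x ≡ + 0
    zero-of {+ zero} _ = refl

  -- The pair (p , q) is (1 , 2) or (2 , 1), whichever lists first the vertex at which the
  -- alternating sequence of mutations continues.
  record State {m} (a : ℤ) (D : Fin (suc m) → Fin (suc m) → ℤ) (p q : Fin (4 ℕ.+ m))
    (f g : Fin (suc m) → ℤ) (f∞ g∞ : ℤ) (c : Fin (suc m) → ℤ) (B : Mat (4 ℕ.+ m)) : Set where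
    field
      roles : Roles p q
      quiv  : IsQuiver B
      pq    : B p q ≡ a
      mp    : ∀ i → B (mid i) p ≡ f i
      qm    : ∀ i → B q (mid i) ≡ g i
      lp    : B last p ≡ f∞
      ql    : B q last ≡ g∞
      mm    : ∀ i j → B (mid i) (mid j) ≡ D i j
      ml    : ∀ i → B (mid i) last ≡ c i

    qp : B q p ≡ - a
    qp = trans (quiv q p) (cong -_ pq)

    pm : ∀ i → B p (mid i) ≡ - f i
    pm i = trans (quiv _ _) (cong -_ (mp i))

    mq : ∀ i → B (mid i) q ≡ - g i
    mq i = trans (quiv _ _) (cong -_ (qm i))

    pl : B p last ≡ - f∞
    pl = trans (quiv _ _) (cong -_ lp)

    lq : B last q ≡ - g∞
    lq = trans (quiv _ _) (cong -_ ql)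

    lm : ∀ i → B last (mid i) ≡ - c i
    lm i = trans (quiv _ _) (cong -_ (ml i))

  module _ {a : ℤ} {D : Fin (suc m) → Fin (suc m) → ℤ} {p q : Fin (4 ℕ.+ m)} where

    -- The weights and skew-symmetry fix every entry, so two mutation sequences are compared by
    -- their weights alone.
    State-unique : ∀ {f g f∞ g∞ c B B′} →
      State a D p q f g f∞ g∞ c B → State a D p q f g f∞ g∞ c B′ → B ≋ B′
    State-unique {B = B} {B′} S S′ i j = go (classify S.roles i) (classify S.roles j)
      where
      module S = State S
      module S′ = State S′
      go : ∀ {i j} → Class p q i → Class p q j → B i j ≡ B′ i j
      go isP       isP       = diagonal-unique (S.quiv _ _) (S′.quiv _ _)
      go isP       isQ       = trans S.pq (sym S′.pq)
      go isP       (isMid j) = trans (S.pm j) (sym (S′.pm j))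
      go isP       isLast    = trans S.pl (sym S′.pl)
      go isQ       isP       = trans S.qp (sym S′.qp)
      go isQ       isQ       = diagonal-unique (S.quiv _ _) (S′.quiv _ _)
      go isQ       (isMid j) = trans (S.qm j) (sym (S′.qm j))
      go isQ       isLast    = trans S.ql (sym S′.ql)
      go (isMid i) isP       = trans (S.mp i) (sym (S′.mp i))
      go (isMid i) isQ       = trans (S.mq i) (sym (S′.mq i))
      go (isMid i) (isMid j) = trans (S.mm i j) (sym (S′.mm i j))
      go (isMid i) isLast    = trans (S.ml i) (sym (S′.ml i))
      go isLast    isP       = trans S.lp (sym S′.lp)
      go isLast    isQ       = trans S.lq (sym S′.lq)
      go isLast    (isMid j) = trans (S.lm j) (sym (S′.lm j))
      go isLast    isLast    = diagonal-unique (S.quiv _ _) (S′.quiv _ _)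

    State-subst : ∀ {f g f∞ g∞ c f′ g′ f∞′ g∞′ c′ B} → State a D p q f g f∞ g∞ c B →
      (∀ i → f i ≡ f′ i) → (∀ i → g i ≡ g′ i) → f∞ ≡ f∞′ → g∞ ≡ g∞′ → (∀ i → c i ≡ c′ i) →
      State a D p q f′ g′ f∞′ g∞′ c′ B
    State-subst S ef eg refl refl ec = record
      { roles = roles ; quiv = quiv ; pq = pq
      ; mp = λ i → trans (mp i) (ef i) ; qm = λ i → trans (qm i) (eg i)
      ; lp = lp ; ql = ql ; mm = mm ; ml = λ i → trans (ml i) (ec i) }
      where open State S

    module _ {f g f∞ g∞ c B} (0≤a : + 0 ≤ a) (S : State a D p q f g f∞ g∞ c B) where
      open State S

      private
        q≢p : q ≢ p
        q≢p = P≢Q roles ∘ sym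
        m≢p : ∀ {z} → suc (suc z) ≢ p
        m≢p = other≢P roles
        m≢q : ∀ {z} → suc (suc z) ≢ q
        m≢q = other≢Q roles
        0≤pq : + 0 ≤ B p q
        0≤pq = subst (+ 0 ≤_) (sym pq) 0≤a

        rearrange : ∀ a f g → - g + f * a ≡ a * f - g
        rearrange = solve-∀
        rearrange′ : ∀ a f g → - f + a * g ≡ a * g - f
        rearrange′ = solve-∀

        nonneg : ∀ {x y} → x ≡ y → + 0 ≤ y → + 0 ≤ x
        nonneg refl p = p
        nonpos : ∀ {x y} → x ≡ - y → + 0 ≤ y → x ≤ + 0
        nonpos refl p = neg≤0 p
        nonneg′ : ∀ {x y} → x ≡ - y → y ≤ + 0 → + 0 ≤ x
        nonneg′ refl p = 0≤neg p
        nonpos′ : ∀ {x y} → x ≡ y → y ≤ + 0 → x ≤ + 0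
        nonpos′ refl p = p

      module _ (0≤f : ∀ i → + 0 ≤ f i) where

        private
          step-mp : ∀ i → μ p B (mid i) q ≡ a * f i - g i
          step-mp i = trans (μ-++ B m≢p q≢p (nonneg (mp i) (0≤f i)) 0≤pq)
            (trans (cong₂ _+_ (mq i) (cong₂ _*_ (mp i) pq)) (rearrange a (f i) (g i)))

          step-qm : ∀ i → μ p B p (mid i) ≡ f i
          step-qm i = trans (μ-source p B (mid i)) (trans (sym (quiv _ _)) (mp i))

          step-pq : μ p B q p ≡ a
          step-pq = trans (μ-target p B q) (trans (sym (quiv _ _)) pq)

          step-mm : ∀ i j → μ p B (mid i) (mid j) ≡ D i j
          step-mm i j = trans (μ-+- B m≢p m≢p (nonneg (mp i) (0≤f i)) (nonpos (pm j) (0≤f j))) (mm i j)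

          step-ql : μ p B p last ≡ f∞
          step-ql = trans (μ-source p B last) (trans (sym (quiv _ _)) lp)

        -- No arrow leaves `p` except towards `q`, so corrections occur only at `q`: the weights
        -- advance along the recurrence and `c` stays.
        mutate-P : + 0 ≤ f∞ →
          State a D q p (λ i → a * f i - g i) f (a * f∞ - g∞) f∞ c (μ p B)
        mutate-P 0≤f∞ = record
          { roles = swapRoles roles ; quiv = μ-quiver p quiv
          ; pq = step-pq ; mp = step-mp ; qm = step-qm
          ; lp = trans (μ-++ B m≢p q≢p (nonneg lp 0≤f∞) 0≤pq)
              (trans (cong₂ _+_ lq (cong₂ _*_ lp pq)) (rearrange a f∞ g∞))
          ; ql = step-ql
          ; mm = step-mm
          ; ml = λ i → trans (μ-+- B m≢p m≢p (nonneg (mp i) (0≤f i)) (nonpos pl 0≤f∞)) (ml i)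
          }

        -- Now `p` may also point to n: the paths from `mid i` over `p` to n are added to `c`, and
        -- the weight between n and `q` gets no correction.
        mutate-P-neg : f∞ ≤ + 0 →
          State a D q p (λ i → a * f i - g i) f (- g∞) f∞ (λ i → c i + f i * (- f∞)) (μ p B)
        mutate-P-neg f∞≤0 = record
          { roles = swapRoles roles ; quiv = μ-quiver p quiv
          ; pq = step-pq ; mp = step-mp ; qm = step-qm
          ; lp = trans (μ--+ B m≢p q≢p (nonpos′ lp f∞≤0) 0≤pq) lq
          ; ql = step-ql
          ; mm = step-mm
          ; ml = λ i → trans (μ-++ B m≢p m≢p (nonneg (mp i) (0≤f i)) (nonneg′ pl f∞≤0))
              (cong₂ _+_ (ml i) (cong₂ _*_ (mp i) pl))
          }

      -- No arrow leaves `q` except towards n. This is the situation at 2, and then at 1, after the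
      -- sink mutations.
      mutate-Q-neg : (∀ i → g i ≤ + 0) → + 0 ≤ g∞ →
        State a D q p g (λ i → - f i) g∞ (a * g∞ - f∞) (λ i → c i + (- g i) * g∞) (μ q B)
      mutate-Q-neg g≤0 0≤g∞ = record
        { roles = swapRoles roles ; quiv = μ-quiver q quiv
        ; pq = trans (μ-source q B p) (trans (sym (quiv _ _)) pq)
        ; mp = λ i → trans (μ-target q B (mid i)) (trans (sym (quiv _ _)) (qm i))
        ; qm = λ i → trans (μ-+- B (q≢p ∘ sym) m≢q 0≤pq (nonpos′ (qm i) (g≤0 i))) (pm i)
        ; lp = trans (μ-target q B last) (trans (sym (quiv _ _)) ql)
        ; ql = trans (μ-++ B (q≢p ∘ sym) m≢q 0≤pq (nonneg ql 0≤g∞))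
            (trans (cong₂ _+_ pl (cong₂ _*_ pq ql)) (rearrange′ a f∞ g∞))
        ; mm = λ i j → trans (μ-+- B m≢q m≢q (nonneg′ (mq i) (g≤0 i)) (nonpos′ (qm j) (g≤0 j))) (mm i j)
        ; ml = λ i → trans (μ-++ B m≢q m≢q (nonneg′ (mq i) (g≤0 i)) (nonneg ql 0≤g∞))
            (cong₂ _+_ (ml i) (cong₂ _*_ (mq i) ql))
        }

  -- The same bookkeeping without vertex n.
  record Wound {m} (a : ℤ) (D : Fin (suc m) → Fin (suc m) → ℤ) (p q : Fin (3 ℕ.+ m))
    (f g : Fin (suc m) → ℤ) (B : Mat (3 ℕ.+ m)) : Set where
    field
      roles : Roles p q
      quiv  : IsQuiver B
      pq    : B p q ≡ a
      mp    : ∀ i → B (suc (suc i)) p ≡ f i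
      qm    : ∀ i → B q (suc (suc i)) ≡ g i
      mm    : ∀ i j → B (suc (suc i)) (suc (suc j)) ≡ D i j

  -- Mutation at `q` raises the indices of these weights, whereas on the paths from `Q` mutation at
  -- `p` lowers them.
  Wound-mutate : ∀ {a D} {p q : Fin (3 ℕ.+ m)} {f g B} → + 0 ≤ a → (∀ i → + 0 ≤ g i) →
    Wound a D p q f g B → Wound a D q p g (λ i → a * g i - f i) (μ q B)
  Wound-mutate {a = a} {p = p} {q} {f} {g} {B} 0≤a 0≤g S = record
    { roles = swapRoles roles ; quiv = μ-quiver q quiv
    ; pq = trans (μ-source q B p) (trans (sym (quiv _ _)) pq)
    ; mp = λ i → trans (μ-target q B _) (trans (sym (quiv _ _)) (qm i))
    ; qm = λ i → trans (μ-++ B (P≢Q roles) (other≢Q roles) (subst (+ 0 ≤_) (sym pq) 0≤a) (0≤qm i))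
        (trans (cong₂ _+_ (trans (quiv _ _) (cong -_ (mp i))) (cong₂ _*_ pq (qm i)))
          (rearrange a (f i) (g i)))
    ; mm = λ i j → trans (μ--+ B (other≢Q roles) (other≢Q roles)
        (subst (_≤ + 0) (sym (quiv _ _)) (neg≤0 (0≤qm i))) (0≤qm j)) (mm i j)
    }
    where
    open Wound S
    0≤qm : ∀ i → + 0 ≤ B q (suc (suc i))
    0≤qm i = subst (+ 0 ≤_) (sym (qm i)) (0≤g i)
    rearrange : ∀ a f g → - f + a * g ≡ a * g - f
    rearrange = solve-∀

  -- Mutations leaving the path

  -- Abundance leaves `x → z` or `z → x`, and the latter would close a cycle of strictly rising
  -- ranks.
  rank-acyclic : ∀ {B : Mat n} → IsQuiver B → Abundant B → ∀ {S : Fin n → Set} (rank : Fin n → ℕ) →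
    (∀ {x y} → S x → S y → Arr B x y → rank x ℕ.< rank y) →
    ∀ {x y z} → S x → S y → S z → Arr B x y → Arr B y z → Arr B x z
  rank-acyclic {B = B} quiv abundant rank up {x} {y} {z} sx sy sz x→y y→z
    with abundant x z (λ { refl → Arr-asym quiv {x} {y} x→y y→z })
  ... | inj₁ x→z = x→z
  ... | inj₂ z→x = contradiction (ℕ.<-trans (up sx sy x→y) (ℕ.<-trans (up sy sz y→z) (up sz sx z→x)))
                     (ℕ.<-irrefl refl)

  -- Vertex n is a source or a sink of the subquiver on 3, …, n; when it is a sink and there are
  -- arrows from n to q, they are dominated by the arrows from 3, …, n - 1 to n.
  data LastArrows {m} (f∞ g∞ : ℤ) (c : Fin (suc m) → ℤ) : Set where
    source : (∀ i → + 2 ≤ - c i) → + 2 ≤ f∞ → + 2 ≤ g∞ ⊎ + 2 ≤ - g∞ → LastArrows f∞ g∞ c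
    sink   : (∀ i → + 2 ≤ c i) → + 2 ≤ f∞ ⊎ + 2 ≤ - f∞ → + 2 ≤ g∞ ⊎ (+ 2 ≤ - g∞ × ∀ i → - g∞ < c i) →
             LastArrows f∞ g∞ c

  module Neighbours {m} {a : ℤ} {D : Fin (suc m) → Fin (suc m) → ℤ} {p q : Fin (4 ℕ.+ m)} {f g f∞ g∞ c B}
    (S : State a D p q f g f∞ g∞ c B)
    (2≤a : + 2 ≤ a) (2≤D : ∀ {i j} → i Fin.< j → + 2 ≤ D i j)
    (2≤f : ∀ i → + 2 ≤ f i) (2≤g : ∀ i → + 2 ≤ g i) where

    open State S

    private
      at : ∀ {x y} → x ≡ y → + 2 ≤ y → + 2 ≤ x
      at refl p = p

      P→Q : Arr B p q
      P→Q = at pq 2≤a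

      M→P : ∀ i → Arr B (mid i) p
      M→P i = at (mp i) (2≤f i)

      Q→M : ∀ i → Arr B q (mid i)
      Q→M i = at (qm i) (2≤g i)

      M→M : ∀ {i j} → i Fin.< j → Arr B (mid i) (mid j)
      M→M i<j = at (mm _ _) (2≤D i<j)

      M→M⁻¹ : ∀ {i j} → Arr B (mid i) (mid j) → toℕ i ℕ.< toℕ j
      M→M⁻¹ {i} {j} i→j with <-cmp i j
      ... | tri< i<j _ _  = i<j
      ... | tri≈ _ refl _ = contradiction i→j (Arr-irrefl quiv)
      ... | tri> _ _ j<i  = contradiction (M→M j<i) (Arr-asym quiv i→j)

      antisym : ∀ {x y} {A : Set} → Arr B x y → Arr B y x → A
      antisym {x} {y} s t = contradiction t (Arr-asym quiv {x} {y} s)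

      no-loop : ∀ {x} {A : Set} → Arr B x x → A
      no-loop {x} s = contradiction s (Arr-irrefl quiv {x})

      -- A path with a parallel arrow dominates at once. Against an opposing arrow it suffices that
      -- this is smaller than the second (`shrinkʳ`) or the first (`shrinkˡ`) arrow of the path.
      grow : ∀ {u v w} → Arr B u w → Arr B w v → Arr B u v → Dominates (B u w) (B w v) (B u v)
      grow s t r = dominates-nonneg s t (2≤⇒0≤ r)

      shrinkʳ : ∀ {u v w} → Arr B u w → Arr B w v → B v u < B w v → Dominates (B u w) (B w v) (B u v)
      shrinkʳ {u} {v} s t r rewrite quiv u v = dominates-neg s t r

      shrinkˡ : ∀ {u v w} → Arr B u w → Arr B w v → B v u < B u w → Dominates (B u w) (B w v) (B u v)
      shrinkˡ {u} {v} {w} s t r rewrite quiv u v =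
        dominates-swap {B w v} {B u w} {z = - B v u} (dominates-neg t s r)

      rank : ℕ → ℕ → ℕ → ∀ {z} → Class p q z → ℕ
      rank rp rq rl isP       = rp
      rank rp rq rl isQ       = rq
      rank rp rq rl (isMid i) = 2 ℕ.+ toℕ i
      rank rp rq rl isLast    = rl

      class : ∀ z → Class p q z
      class = classify roles

      top : ∀ (i : Fin (suc m)) {N} → 2 ℕ.+ toℕ i ℕ.< 3 ℕ.+ N ℕ.+ m
      top i {N} = s≤s (s≤s (ℕ.<-≤-trans (toℕ<n i) (s≤s (ℕ.m≤n+m m N))))

    -- All vertices but n lie on the triangles `p → q → mid i → p`, so only n needs to be examined.
    NoSourceSink-interior : (∃ λ u → Arr B u last) → (∃ λ v → Arr B last v) → NoSourceSink B
    NoSourceSink-interior into from z = go (class z)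
      where
      go : ∀ {z} → Class p q z → (∃ λ u → Arr B u z) × (∃ λ v → Arr B z v)
      go isP       = (mid zero , M→P zero) , (q , P→Q)
      go isQ       = (p , P→Q) , (mid zero , Q→M zero)
      go (isMid i) = (q , Q→M i) , (p , M→P i)
      go isLast    = into , from

    OnTriangle-≢last : ∀ {z} → z ≢ last → OnTriangle B z
    OnTriangle-≢last {z} = go (class z)
      where
      go : ∀ {z} → Class p q z → z ≢ last → OnTriangle B z
      go isP       _      = q , mid zero , P→Q , Q→M zero , M→P zero
      go isQ       _      = mid zero , p , Q→M zero , M→P zero , P→Q
      go (isMid i) _      = p , q , M→P i , P→Q , Q→M i
      go isLast    z≢last = contradiction refl z≢last

    module _ (Last : LastArrows f∞ g∞ c) where

      private
        L→P : + 2 ≤ f∞ → Arr B last p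
        L→P = at lp

        P→L : + 2 ≤ - f∞ → Arr B p last
        P→L = at pl

        Q→L : + 2 ≤ g∞ → Arr B q last
        Q→L = at ql

        L→Q : + 2 ≤ - g∞ → Arr B last q
        L→Q = at lq

        signᶠ : LastArrows f∞ g∞ c → Arr B last p ⊎ Arr B p last
        signᶠ (source _ s _)        = inj₁ (L→P s)
        signᶠ (sink _ (inj₁ s) _)   = inj₁ (L→P s)
        signᶠ (sink _ (inj₂ s) _)   = inj₂ (P→L s)

        signᵍ : LastArrows f∞ g∞ c → Arr B q last ⊎ Arr B last q
        signᵍ (source _ _ (inj₁ s))     = inj₁ (Q→L s)
        signᵍ (source _ _ (inj₂ s))     = inj₂ (L→Q s)
        signᵍ (sink _ _ (inj₁ s))       = inj₁ (Q→L s)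
        signᵍ (sink _ _ (inj₂ (s , _))) = inj₂ (L→Q s)

        signᶜ : LastArrows f∞ g∞ c → (∀ i → Arr B last (mid i)) ⊎ (∀ i → Arr B (mid i) last)
        signᶜ (source s _ _) = inj₁ λ i → at (lm i) (s i)
        signᶜ (sink s _ _)   = inj₂ λ i → at (ml i) (s i)

      abundant : Abundant B
      abundant x y = go (class x) (class y)
        where
        flip : ∀ {x y} → Arr B x y ⊎ Arr B y x → Arr B y x ⊎ Arr B x y
        flip (inj₁ s) = inj₂ s
        flip (inj₂ s) = inj₁ s
        M-L : ∀ i → Arr B (mid i) last ⊎ Arr B last (mid i)
        M-L i with signᶜ Last
        ... | inj₁ s = inj₂ (s i)
        ... | inj₂ s = inj₁ (s i)
        go : ∀ {x y} → Class p q x → Class p q y → x ≢ y → Arr B x y ⊎ Arr B y x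
        go isP       isP       x≢y = contradiction refl x≢y
        go isP       isQ       _   = inj₁ P→Q
        go isP       (isMid j) _   = inj₂ (M→P j)
        go isP       isLast    _   = flip (signᶠ Last)
        go isQ       isP       _   = inj₂ P→Q
        go isQ       isQ       x≢y = contradiction refl x≢y
        go isQ       (isMid j) _   = inj₁ (Q→M j)
        go isQ       isLast    _   = signᵍ Last
        go (isMid i) isP       _   = inj₁ (M→P i)
        go (isMid i) isQ       _   = inj₂ (Q→M i)
        go (isMid i) (isMid j) x≢y with <-cmp i j
        ... | tri< i<j _ _  = inj₁ (M→M i<j)
        ... | tri≈ _ refl _ = contradiction refl x≢y
        ... | tri> _ _ j<i  = inj₂ (M→M j<i)
        go (isMid i) isLast    _   = M-L i
        go isLast    isP       _   = signᶠ Last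
        go isLast    isQ       _   = flip (signᵍ Last)
        go isLast    (isMid j) _   = flip (M-L j)
        go isLast    isLast    x≢y = contradiction refl x≢y

      private
        module _ (S : Fin (4 ℕ.+ m) → Set) (rp rq rl : ℕ) where

          private
            r : ∀ {z} → Class p q z → ℕ
            r = rank rp rq rl

            ranked : (∀ {x y} (x′ : Class p q x) (y′ : Class p q y) → S x → S y → Arr B x y → r x′ ℕ.< r y′) →
              ∀ {x y z} → S x → S y → S z → Arr B x y → Arr B y z → Arr B x z
            ranked up = rank-acyclic quiv abundant (λ z → r (class z)) (up (class _) (class _))

          -- Without `q` the vertices 3, ..., n - 1 come in their natural order and `p` after them;
          -- the rank `rl` says where n is inserted.
          acyclic-avoiding-Q : (∀ {x} → S x → x ≢ q) → (∀ (i : Fin (suc m)) → 2 ℕ.+ toℕ i ℕ.< rp) →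
            (Arr B p last → rp ℕ.< rl) → (Arr B last p → rl ℕ.< rp) →
            (∀ i → Arr B (mid i) last → 2 ℕ.+ toℕ i ℕ.< rl) → (∀ i → Arr B last (mid i) → rl ℕ.< 2 ℕ.+ toℕ i) →
            ∀ {x y z} → S x → S y → S z → Arr B x y → Arr B y z → Arr B x z
          acyclic-avoiding-Q S⇒≢q <rp P-L L-P M-L L-M = ranked up
            where
            up : ∀ {x y} (x′ : Class p q x) (y′ : Class p q y) → S x → S y → Arr B x y → r x′ ℕ.< r y′
            up isQ       _         s _ _ = contradiction refl (S⇒≢q s)
            up _         isQ       _ s _ = contradiction refl (S⇒≢q s)
            up isP       isP       _ _ t = no-loop t
            up isP       (isMid j) _ _ t = antisym t (M→P j)
            up isP       isLast    _ _ t = P-L t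
            up (isMid i) isP       _ _ _ = <rp i
            up (isMid i) (isMid j) _ _ t = s≤s (s≤s (M→M⁻¹ t))
            up (isMid i) isLast    _ _ t = M-L i t
            up isLast    isP       _ _ t = L-P t
            up isLast    (isMid j) _ _ t = L-M j t
            up isLast    isLast    _ _ t = no-loop t

          -- The conditions on n are guarded by `S last`: n may lie on an oriented triangle with `q`
          -- and `mid i`, and then it has to be outside `S`.
          acyclic-avoiding-P : (∀ {x} → S x → x ≢ p) → rq ℕ.< 2 →
            (S last → Arr B q last → rq ℕ.< rl) → (S last → Arr B last q → rl ℕ.< rq) →
            (S last → ∀ i → Arr B (mid i) last → 2 ℕ.+ toℕ i ℕ.< rl) →
            (S last → ∀ i → Arr B last (mid i) → rl ℕ.< 2 ℕ.+ toℕ i) →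
            ∀ {x y z} → S x → S y → S z → Arr B x y → Arr B y z → Arr B x z
          acyclic-avoiding-P S⇒≢p rq<2 Q-L L-Q M-L L-M = ranked up
            where
            up : ∀ {x y} (x′ : Class p q x) (y′ : Class p q y) → S x → S y → Arr B x y → r x′ ℕ.< r y′
            up isP       _         s _ _ = contradiction refl (S⇒≢p s)
            up _         isP       _ s _ = contradiction refl (S⇒≢p s)
            up isQ       isQ       _ _ t = no-loop t
            up isQ       (isMid j) _ _ t = ℕ.<-≤-trans rq<2 (ℕ.m≤m+n 2 (toℕ j))
            up isQ       isLast    _ s t = Q-L s t
            up (isMid i) isQ       _ _ t = antisym t (Q→M i)
            up (isMid i) (isMid j) _ _ t = s≤s (s≤s (M→M⁻¹ t))
            up (isMid i) isLast    _ s t = M-L s i t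
            up isLast    isQ       s _ t = L-Q s t
            up isLast    (isMid j) s _ t = L-M s j t
            up isLast    isLast    _ _ t = no-loop t

        -- A source n comes first in the order; otherwise it follows 3, ..., n - 1 and stands just
        -- before or just after `p`.
        acyclic-without-Q : LastArrows f∞ g∞ c →
          ∀ {x y z} → x ≢ q → y ≢ q → z ≢ q → Arr B x y → Arr B y z → Arr B x z
        acyclic-without-Q (source cs fs _) = acyclic-avoiding-Q (_≢ q) (3 ℕ.+ m) 0 0 (λ s → s) (λ i → top i {0})
          (λ t → antisym t (L→P fs)) (λ _ → s≤s z≤n)
          (λ i t → antisym t (at (lm i) (cs i))) (λ _ _ → s≤s z≤n)
        acyclic-without-Q (sink cs (inj₁ fs) _) =
          acyclic-avoiding-Q (_≢ q) (4 ℕ.+ m) 0 (3 ℕ.+ m) (λ s → s) (λ i → top i {1})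
          (λ t → antisym t (L→P fs)) (λ _ → ℕ.≤-refl)
          (λ i _ → top i {0}) (λ i t → antisym t (at (ml i) (cs i)))
        acyclic-without-Q (sink cs (inj₂ fs) _) =
          acyclic-avoiding-Q (_≢ q) (3 ℕ.+ m) 0 (4 ℕ.+ m) (λ s → s) (λ i → top i {0})
          (λ _ → ℕ.≤-refl) (λ t → antisym t (P→L fs))
          (λ i _ → top i {1}) (λ i t → antisym t (at (ml i) (cs i)))

        from≢Q : ∀ {x w} → Arr B q w → Arr B w x → x ≢ q
        from≢Q s t refl = antisym s t

        into≢Q : ∀ {x w} → Arr B w q → Arr B x w → x ≢ q
        into≢Q s t refl = antisym s t

      module _ (f<g : ∀ i → f i < g i) (a<g : ∀ i → a < g i) where

        -- The critical path is `q → mid w → p`, opposed by the arrow `p → q` of multiplicity `a`;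
        -- this is where `a < g w` enters.
        fork-at-mid : ∀ w → Fork (μ (mid w) B) (mid w)
        fork-at-mid w = mutate-fork (mid w) quiv abundant (trans-in Last)
            (λ s t u → acyclic-without-Q Last (from≢Q (Q→M w) s) (from≢Q (Q→M w) t) (from≢Q (Q→M w) u))
            (dominates (class _) (class _)) (q , Q→M w) (p , M→P w)
          where
          into≢P : ∀ {x} → Arr B x (mid w) → x ≢ p
          into≢P s refl = antisym s (M→P w)

          trans-in : LastArrows f∞ g∞ c → ∀ {x y z} → Arr B x (mid w) → Arr B y (mid w) → Arr B z (mid w) →
            Arr B x y → Arr B y z → Arr B x z
          trans-in (source cs _ (inj₁ gs)) = acyclic-avoiding-P (λ x → Arr B x (mid w)) 0 0 1 into≢P (s≤s z≤n)
            (λ _ _ → s≤s z≤n) (λ _ t → antisym t (Q→L gs))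
            (λ _ i t → antisym t (at (lm i) (cs i))) (λ _ _ _ → s≤s (s≤s z≤n))
          trans-in (source cs _ (inj₂ gs)) = acyclic-avoiding-P (λ x → Arr B x (mid w)) 0 1 0 into≢P (s≤s (s≤s z≤n))
            (λ _ t → antisym t (L→Q gs)) (λ _ _ → s≤s z≤n)
            (λ _ i t → antisym t (at (lm i) (cs i))) (λ _ _ _ → s≤s z≤n)
          trans-in (sink cs _ _) = acyclic-avoiding-P (λ x → Arr B x (mid w)) 0 0 0 into≢P (s≤s z≤n)
            absent absent absent absent
            where
            absent : ∀ {A : Set} → Arr B last (mid w) → A
            absent s = antisym s (at (ml w) (cs w))

          dominates : ∀ {x y} → Class p q x → Class p q y → Arr B x (mid w) → Arr B (mid w) y →
            Dominates (B x (mid w)) (B (mid w) y) (B x y)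
          dominates isP       _         s t = antisym s (M→P w)
          dominates _         isQ       s t = antisym t (Q→M w)
          dominates isQ       isP       s t =
            shrinkˡ s t (subst₂ _<_ (sym pq) (sym (qm w)) (a<g w))
          dominates isQ       (isMid j) s t = grow s t (Q→M j)
          dominates (isMid i) isP       s t = grow s t (M→P i)
          dominates (isMid i) (isMid j) s t = grow s t (M→M (ℕ.<-trans (M→M⁻¹ s) (M→M⁻¹ t)))
          dominates isLast    isLast    s t = antisym s t
          dominates isQ       isLast    s t = Q-L Last
            where
            Q-L : LastArrows f∞ g∞ c → Dominates (B q (mid w)) (B (mid w) last) (B q last)
            Q-L (source cs _ _)            = antisym t (at (lm w) (cs w))
            Q-L (sink _ _ (inj₁ gs))       = grow s t (Q→L gs)
            Q-L (sink _ _ (inj₂ (_ , gc))) = shrinkʳ s t (subst₂ _<_ (sym lq) (sym (ml w)) (gc w))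
          dominates (isMid i) isLast    s t = M-L Last
            where
            M-L : LastArrows f∞ g∞ c → Dominates (B (mid i) (mid w)) (B (mid w) last) (B (mid i) last)
            M-L (source cs _ _) = antisym t (at (lm w) (cs w))
            M-L (sink cs _ _)   = grow s t (at (ml i) (cs i))
          dominates isLast    isP       s t = L-P Last
            where
            L-P : LastArrows f∞ g∞ c → Dominates (B last (mid w)) (B (mid w) p) (B last p)
            L-P (source _ fs _) = grow s t (L→P fs)
            L-P (sink cs _ _)   = antisym s (at (ml w) (cs w))
          dominates isLast    (isMid j) s t = L-M Last
            where
            L-M : LastArrows f∞ g∞ c → Dominates (B last (mid w)) (B (mid w) (mid j)) (B last (mid j))
            L-M (source cs _ _) = grow s t (at (lm j) (cs j))
            L-M (sink cs _ _)   = antisym s (at (ml w) (cs w))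

        -- Serves at the two ends of the edge between `Q` and `N`, where vertex 2 is not a direction
        -- of the path. The paths `p → q → mid j` are opposed by `mid j → p`, whence the use of
        -- `f < g`.
        fork-at-Q : (Arr B q last → Arr B p last) → (Arr B last q → ∀ i → Arr B last (mid i)) → Fork (μ q B) q
        fork-at-Q P-L L-M = mutate-fork q quiv abundant
            (λ s t u → acyclic-without-Q Last (Arr⇒≢ quiv s) (Arr⇒≢ quiv t) (Arr⇒≢ quiv u))
            (λ s t u → acyclic-without-Q Last (Arr⇒≢ quiv s ∘ sym) (Arr⇒≢ quiv t ∘ sym) (Arr⇒≢ quiv u ∘ sym))
            (dominates (class _) (class _)) (p , P→Q) (mid zero , Q→M zero)
          where
          dominates : ∀ {x y} → Class p q x → Class p q y → Arr B x q → Arr B q y →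
            Dominates (B x q) (B q y) (B x y)
          dominates isQ       _         s t = no-loop s
          dominates (isMid i) _         s t = antisym s (Q→M i)
          dominates _         isP       s t = antisym t P→Q
          dominates _         isQ       s t = no-loop t
          dominates isP       (isMid j) s t =
            shrinkʳ s t (subst₂ _<_ (sym (mp j)) (sym (qm j)) (f<g j))
          dominates isP       isLast    s t = grow s t (P-L t)
          dominates isLast    (isMid j) s t = grow s t (L-M s j)
          dominates isLast    isLast    s t = antisym s t

      -- The fork lemmas at n differ in the orientation of the arrows at n. In each of them one
      -- neighbourhood of n lies within `p`, `q`, so that its transitivity is immediate; here only
      -- `q` points to n.
      fork-at-last-source : (∀ i → + 2 ≤ - c i) → + 2 ≤ f∞ → + 2 ≤ g∞ → a < f∞ → Fork (μ last B) last
      fork-at-last-source cs fs gs a<f∞ = mutate-fork last quiv abundant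
          (λ s t _ s→t _ → contradiction s→t (only-Q (class _) s (class _) t))
          (λ s t u → acyclic-without-Q Last (from≢Q (Q→L gs) s) (from≢Q (Q→L gs) t) (from≢Q (Q→L gs) u))
          (dominates (class _) (class _)) (q , Q→L gs) (p , L→P fs)
        where
        only-Q : ∀ {x y} → Class p q x → Arr B x last → Class p q y → Arr B y last → ¬ Arr B x y
        only-Q isP       s _         _ = antisym s (L→P fs)
        only-Q (isMid i) s _         _ = antisym s (at (lm i) (cs i))
        only-Q isLast    s _         _ = no-loop s
        only-Q isQ       _ isQ       _ = Arr-irrefl quiv
        only-Q isQ       _ isP       t = antisym t (L→P fs)
        only-Q isQ       _ (isMid j) t = antisym t (at (lm j) (cs j))
        only-Q isQ       _ isLast    t = no-loop t

        dominates : ∀ {x y} → Class p q x → Class p q y → Arr B x last → Arr B last y →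
          Dominates (B x last) (B last y) (B x y)
        dominates isP       _         s t = antisym s (L→P fs)
        dominates (isMid i) _         s t = antisym s (at (lm i) (cs i))
        dominates isLast    _         s t = no-loop s
        dominates isQ       isP       s t = shrinkʳ s t (subst₂ _<_ (sym pq) (sym lp) a<f∞)
        dominates isQ       isQ       s t = antisym s t
        dominates isQ       (isMid j) s t = grow s t (Q→M j)
        dominates isQ       isLast    s t = no-loop t

      module _ (cs : ∀ i → + 2 ≤ c i) where

        private
          M→L : ∀ i → Arr B (mid i) last
          M→L i = at (ml i) (cs i)

        fork-at-last-later : + 2 ≤ f∞ → + 2 ≤ g∞ → a < f∞ → Fork (μ last B) last
        fork-at-last-later fs gs a<f∞ = mutate-fork last quiv abundant
            (acyclic-avoiding-P (λ x → Arr B x last) 0 0 0 (λ { s refl → antisym s (L→P fs) }) (s≤s z≤n)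
              no-loop no-loop no-loop no-loop)
            (λ s t _ s→t _ → contradiction s→t (only-P (class _) s (class _) t))
            (dominates (class _) (class _)) (q , Q→L gs) (p , L→P fs)
          where
          only-P : ∀ {x y} → Class p q x → Arr B last x → Class p q y → Arr B last y → ¬ Arr B x y
          only-P isQ       s _         _ = antisym s (Q→L gs)
          only-P (isMid i) s _         _ = antisym s (M→L i)
          only-P isLast    s _         _ = no-loop s
          only-P isP       _ isP       _ = Arr-irrefl quiv
          only-P isP       _ isQ       t = antisym t (Q→L gs)
          only-P isP       _ (isMid j) t = antisym t (M→L j)
          only-P isP       _ isLast    t = no-loop t

          dominates : ∀ {x y} → Class p q x → Class p q y → Arr B x last → Arr B last y →
            Dominates (B x last) (B last y) (B x y)
          dominates _         isQ       s t = antisym t (Q→L gs)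
          dominates _         (isMid j) s t = antisym t (M→L j)
          dominates _         isLast    s t = no-loop t
          dominates isP       isP       s t = antisym s t
          dominates isQ       isP       s t = shrinkʳ s t (subst₂ _<_ (sym pq) (sym lp) a<f∞)
          dominates (isMid i) isP       s t = grow s t (M→P i)
          dominates isLast    isP       s t = no-loop s

        module _ (g<c : ∀ i → g i < c i) where

          private
            -- The path over n runs against `q → mid i`; the arrows accumulated in `c` outnumber
            -- those.
            M-Q : ∀ i → Arr B (mid i) last → Arr B last q → Dominates (B (mid i) last) (B last q) (B (mid i) q)
            M-Q i s t = shrinkˡ s t (subst₂ _<_ (sym (qm i)) (sym (ml i)) (g<c i))

          fork-at-last-first : + 2 ≤ - f∞ → + 2 ≤ - g∞ → Fork (μ last B) last
          fork-at-last-first fs gs = mutate-fork last quiv abundant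
              (λ s t u → acyclic-without-Q Last (into≢Q (L→Q gs) s) (into≢Q (L→Q gs) t) (into≢Q (L→Q gs) u))
              (λ s t _ s→t _ → contradiction s→t (only-Q (class _) s (class _) t))
              (dominates (class _) (class _)) (p , P→L fs) (q , L→Q gs)
            where
            only-Q : ∀ {x y} → Class p q x → Arr B last x → Class p q y → Arr B last y → ¬ Arr B x y
            only-Q isP       s _         _ = antisym s (P→L fs)
            only-Q (isMid i) s _         _ = antisym s (M→L i)
            only-Q isLast    s _         _ = no-loop s
            only-Q isQ       _ isQ       _ = Arr-irrefl quiv
            only-Q isQ       _ isP       t = antisym t (P→L fs)
            only-Q isQ       _ (isMid j) t = antisym t (M→L j)
            only-Q isQ       _ isLast    t = no-loop t

            dominates : ∀ {x y} → Class p q x → Class p q y → Arr B x last → Arr B last y →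
              Dominates (B x last) (B last y) (B x y)
            dominates _         isP       s t = antisym t (P→L fs)
            dominates _         (isMid j) s t = antisym t (M→L j)
            dominates _         isLast    s t = no-loop t
            dominates isP       isQ       s t = grow s t P→Q
            dominates isQ       isQ       s t = antisym s t
            dominates (isMid i) isQ       s t = M-Q i s t
            dominates isLast    isQ       s t = no-loop s

          fork-at-last-second : + 2 ≤ f∞ → + 2 ≤ - g∞ → Fork (μ last B) last
          fork-at-last-second fs gs = mutate-fork last quiv abundant
              (λ s t u → acyclic-without-Q Last (into≢Q (L→Q gs) s) (into≢Q (L→Q gs) t) (into≢Q (L→Q gs) u))
              (λ s t u s→t t→u → contradiction t→u (no-path (class _) s (class _) t (class _) u s→t))
              (dominates (class _) (class _)) (mid zero , M→L zero) (p , L→P fs)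
            where
            no-path : ∀ {x y z} → Class p q x → Arr B last x → Class p q y → Arr B last y →
              Class p q z → Arr B last z → Arr B x y → ¬ Arr B y z
            no-path (isMid i) s _ _ _ _ _ _ = antisym s (M→L i)
            no-path _ _ (isMid j) t _ _ _ _ = antisym t (M→L j)
            no-path _ _ _ _ (isMid k) u _ _ = antisym u (M→L k)
            no-path isLast s _ _ _ _ _ _    = no-loop s
            no-path _ _ isLast t _ _ _ _    = no-loop t
            no-path _ _ _ _ isLast u _ _    = no-loop u
            no-path isP _ isP _ _ _ s _     = no-loop s
            no-path isP _ isQ _ isP _ _ t   = antisym t P→Q
            no-path isP _ isQ _ isQ _ _ t   = no-loop t
            no-path isQ _ isP _ _ _ s _     = antisym s P→Q
            no-path isQ _ isQ _ _ _ s _     = no-loop s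

            dominates : ∀ {x y} → Class p q x → Class p q y → Arr B x last → Arr B last y →
              Dominates (B x last) (B last y) (B x y)
            dominates isP       _         s t = antisym s (L→P fs)
            dominates isQ       _         s t = antisym s (L→Q gs)
            dominates isLast    _         s t = no-loop s
            dominates _         (isMid j) s t = antisym t (M→L j)
            dominates _         isLast    s t = no-loop t
            dominates (isMid i) isP       s t = grow s t (M→P i)
            dominates (isMid i) isQ       s t = M-Q i s t

  -- The two paths starting at Q

  alternate : ℕ → Fin (2 ℕ.+ n)
  alternate zero          = v₁
  alternate (suc zero)    = v₂
  alternate (suc (suc t)) = alternate t

  alternate-roles : ∀ t → Roles {n} (alternate t) (alternate (suc t))
  alternate-roles zero          = r₁₂
  alternate-roles (suc zero)    = r₂₁
  alternate-roles (suc (suc t)) = alternate-roles t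

  alternate-even : ∀ k → alternate {n} (k ℕ.* 2) ≡ v₁
  alternate-even zero    = refl
  alternate-even (suc k) = alternate-even k

  alternate-odd : ∀ k → alternate {n} (suc (k ℕ.* 2)) ≡ v₂
  alternate-odd zero    = refl
  alternate-odd (suc k) = alternate-odd k

  orbit : Mat (2 ℕ.+ n) → ℕ → Mat (2 ℕ.+ n)
  orbit B zero    = B
  orbit B (suc t) = μ (alternate t) (orbit B t)

  orbit-quiver : ∀ {B : Mat (2 ℕ.+ n)} → IsQuiver B → ∀ t → IsQuiver (orbit B t)
  orbit-quiver quiv zero    = quiv
  orbit-quiver quiv (suc t) = μ-quiver (alternate t) (orbit-quiver quiv t)

  orbit-shift : ∀ (B : Mat (2 ℕ.+ n)) t → orbit (orbit B 2) t ≡ orbit B (2 ℕ.+ t)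
  orbit-shift B zero    = refl
  orbit-shift B (suc t) = cong (μ (alternate t)) (orbit-shift B t)

  alt12-orbit : ∀ k (B : Mat (2 ℕ.+ n)) → μs (alt12 k) B ≡ orbit B (k ℕ.* 2)
  alt12-orbit zero    B = refl
  alt12-orbit (suc k) B = trans (alt12-orbit k (orbit B 2)) (orbit-shift B (k ℕ.* 2))

  countdown : ℕ → List (Fin (2 ℕ.+ n))
  countdown zero    = []
  countdown (suc t) = alternate t ∷ countdown t

  alt21-countdown : ∀ k → alt21 {n} k ≡ countdown (k ℕ.* 2)
  alt21-countdown zero    = refl
  alt21-countdown (suc k) = cong₂ _∷_ (sym (alternate-odd k))
    (cong₂ _∷_ (sym (alternate-even k)) (alt21-countdown k))

  module _ {a : ℤ} {D : Fin (suc m) → Fin (suc m) → ℤ} {p q : Fin (4 ℕ.+ m)} {f g f∞ g∞ c B}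
    (S : State a D p q f g f∞ g∞ c B) where
    open State S

    mutate-sink : (∀ z → + 0 ≤ B z last) →
      State a D p q f g (- f∞) (- g∞) (λ i → - c i) (μ last B)
    mutate-sink into = record
      { roles = roles ; quiv = μ-quiver last quiv
      ; pq = trans (keep (other≢P roles ∘ sym) (other≢Q roles ∘ sym)) pq
      ; mp = λ i → trans (keep mid≢last (other≢P roles ∘ sym)) (mp i)
      ; qm = λ i → trans (keep (other≢Q roles ∘ sym) mid≢last) (qm i)
      ; lp = trans (μ-source last B p) (cong -_ lp)
      ; ql = trans (μ-target last B q) (cong -_ ql)
      ; mm = λ i j → trans (keep mid≢last mid≢last) (mm i j)
      ; ml = λ i → trans (μ-target last B (mid i)) (cong -_ (ml i))
      }
      where
      keep : ∀ {x y} → x ≢ last → y ≢ last → μ last B x y ≡ B x y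
      keep {x} {y} x≢ y≢ = μ-+- B x≢ y≢ (into x) (subst (_≤ + 0) (sym (quiv last y)) (neg≤0 (into y)))

    -- The arrows between `p` and `mid i` have turned round, so the triangles are now
    -- `p → mid i → n → p`, and only `q` needs an argument of its own.
    NoSourceSink-end : + 2 ≤ a → (∀ i → + 2 ≤ - f i) → + 2 ≤ f∞ → (∀ i → + 2 ≤ c i) →
      (∃ λ v → Arr B q v) → NoSourceSink B
    NoSourceSink-end 2≤a 2≤-f 2≤f∞ 2≤c from z = go (classify roles z)
      where
      P→Q = subst (+ 2 ≤_) (sym pq) 2≤a
      L→P = subst (+ 2 ≤_) (sym lp) 2≤f∞
      P→M = λ i → subst (+ 2 ≤_) (sym (pm i)) (2≤-f i)
      M→L = λ i → subst (+ 2 ≤_) (sym (ml i)) (2≤c i)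
      go : ∀ {z} → Class p q z → (∃ λ u → Arr B u z) × (∃ λ v → Arr B z v)
      go isP       = (last , L→P) , (q , P→Q)
      go isQ       = (p , P→Q) , from
      go (isMid i) = (p , P→M i) , (last , M→L i)
      go isLast    = (mid zero , M→L zero) , (p , L→P)

  ¬2≤0 : ∀ {x} → x ≤ + 0 → ¬ (+ 2 ≤ x)
  ¬2≤0 p q with ≤-trans q p
  ... | ℤ.+≤+ ()

  -- x i, y i, s i, p₀ and q₀ are the multiplicities of the arrows 1 → i, 2 → i (in R̃), i → n, 1 → n
  -- and 2 → n (in Q), for 3 ≤ i < n; the word has 2k = K = 2 + K′ letters.
  module Orbits {m} (k′ : ℕ) {a : ℤ} {D : Fin (suc m) → Fin (suc m) → ℤ}
    (x y s : Fin (suc m) → ℤ) (p₀ q₀ : ℤ)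
    (2≤a : + 2 ≤ a) (2≤D : ∀ {i j} → i Fin.< j → + 2 ≤ D i j)
    (2≤x : ∀ i → + 2 ≤ x i) (2≤y : ∀ i → + 2 ≤ y i) (2≤s : ∀ i → + 2 ≤ s i)
    (2≤p₀ : + 2 ≤ p₀) (2≤q₀ : + 2 ≤ q₀) where

    K′ K : ℕ
    K′ = k′ ℕ.* 2
    K  = suc k′ ℕ.* 2

    u : Fin (suc m) → ℕ → ℤ
    u i = W a (x i) (y i)

    -- The starting values are chosen so that mutating `Q` at n makes the weights between n and the
    -- pair 1, 2 the consecutive terms `v 1` and `v 0`.
    v : ℕ → ℤ
    v = W a q₀ p₀

    0≤a : + 0 ≤ a
    0≤a = 2≤⇒0≤ 2≤a

    2≤u : ∀ i t → + 2 ≤ u i (suc t)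
    2≤u i = 2≤W 2≤a (2≤x i) (2≤y i)

    u-mono : ∀ i t → u i (suc t) < u i (suc (suc t))
    u-mono i = W-mono-< 2≤a (2≤x i) (2≤y i)

    a<u : ∀ i t → a < u i (suc (suc t))
    a<u i = a<W 2≤a (2≤x i) (2≤y i)

    2≤v : ∀ t → + 2 ≤ v (suc t)
    2≤v = 2≤W 2≤a 2≤q₀ 2≤p₀

    v-mono : ∀ t → v (suc t) < v (suc (suc t))
    v-mono = W-mono-< 2≤a 2≤q₀ 2≤p₀

    a<v : ∀ t → a < v (suc (suc t))
    a<v = a<W 2≤a 2≤q₀ 2≤p₀

    v₀≤0 : v 0 ≤ + 0
    v₀≤0 = neg≤0 (2≤⇒0≤ 2≤q₀)

    2≤-v₀ : + 2 ≤ - v 0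
    2≤-v₀ = subst (+ 2 ≤_) (sym (neg-involutive q₀)) 2≤q₀

    -- The multiplicities of the arrows from `mid i` to n one and two steps from `Q` along 1, 2, 1,
    -- 2, ...; they stay at `c₂` afterwards.
    c₁ c₂ : Fin (suc m) → ℤ
    c₁ i = s i + u i K * v 1
    c₂ i = c₁ i + u i (suc K′) * (- v 0)

    private
      D₁ : ∀ i → Dominates (u i K) (v 1) (s i)
      D₁ i = dominates-nonneg (2≤u i (suc K′)) 2≤p₀ (2≤⇒0≤ (2≤s i))

    2≤c₁ : ∀ i → + 2 ≤ c₁ i
    2≤c₁ i = ≤-trans 2≤p₀ (<⇒≤ (proj₂ (D₁ i)))

    private
      D₂ : ∀ i → Dominates (u i (suc K′)) (- v 0) (c₁ i)
      D₂ i = dominates-nonneg (2≤u i K′) 2≤-v₀ (2≤⇒0≤ (2≤c₁ i))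

    2≤c₂ : ∀ i → + 2 ≤ c₂ i
    2≤c₂ i = ≤-trans (2≤u i K′) (<⇒≤ (proj₁ (D₂ i)))

    IsQ : Mat (4 ℕ.+ m) → Set
    IsQ = State a D v₁ v₂ (λ i → u i K) (λ i → u i (suc K)) (- v 1) (- v 0) s

    module _ {Q : Mat (4 ℕ.+ m)} (SQ : IsQ Q) where

      N : Mat (4 ℕ.+ m)
      N = μ last Q

      private
        module Q = State SQ

        into-last : ∀ z → + 0 ≤ Q z last
        into-last z = go (classify r₁₂ z)
          where
          nonneg : ∀ {x y} → x ≡ y → + 0 ≤ y → + 0 ≤ x
          nonneg refl p = p
          go : ∀ {z} → Class v₁ v₂ z → + 0 ≤ Q z last
          go isP       = nonneg (trans Q.pl (neg-involutive _)) (2≤⇒0≤ 2≤p₀)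
          go isQ       = nonneg Q.ql (2≤⇒0≤ 2≤-v₀)
          go (isMid i) = nonneg (Q.ml i) (2≤⇒0≤ (2≤s i))
          go isLast    = nonneg (diagonal-unique {y = + 0} (Q.quiv last last) refl) ≤-refl

      Q-has-sink : ¬ NoSourceSink Q
      Q-has-sink noSS with proj₂ (noSS last)
      ... | z , last→z = ¬2≤0 (subst (_≤ + 0) (sym (Q.quiv last z)) (neg≤0 (into-last z))) last→z

      N-has-source : ¬ NoSourceSink N
      N-has-source noSS with proj₁ (noSS last)
      ... | z , z→last = ¬2≤0 (subst (_≤ + 0) (sym (μ-target last Q z)) (neg≤0 (into-last z))) z→last

      IsX : ℕ → ℕ → Mat (4 ℕ.+ m) → Set
      IsX t d = State a D (alternate t) (alternate (suc t))
        (λ i → u i d) (λ i → u i (suc d)) (v (suc t)) (v t) (λ i → - s i)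

      -- The same mutations unwind the weights at `mid i` (index `d`) and wind up those at n (index
      -- `t`).
      X-state : ∀ t d → t ℕ.+ d ≡ K → IsX t d (orbit N t)
      X-state zero    d refl = State-subst (mutate-sink SQ into-last)
        (λ _ → refl) (λ _ → refl) (neg-involutive _) (neg-involutive _) (λ _ → refl)
      X-state (suc t) d eq   = State-subst
        (mutate-P 0≤a (X-state t (suc d) (trans (ℕ.+-suc t d) eq))
          (λ i → 2≤⇒0≤ (2≤u i d)) (2≤⇒0≤ (2≤v t)))
        (λ i → W-back a (u i d) (u i (suc d))) (λ _ → refl) refl refl (λ _ → refl)

      Y₁-state : State a D v₂ v₁ (λ i → u i (suc K′)) (λ i → u i K) (v 0) (- v 1) c₁ (orbit Q 1)
      Y₁-state = State-subst
        (mutate-P-neg 0≤a SQ (λ i → 2≤⇒0≤ (2≤u i (suc K′))) (neg≤0 (2≤⇒0≤ 2≤p₀)))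
        (λ i → W-back a (u i (suc K′)) (u i K)) (λ _ → refl) (neg-involutive _) refl
        (λ i → cong (λ e → s i + u i K * e) (neg-involutive (v 1)))

      -- Two steps after `Q` the weights at n are `v 1` and `v 0`, just as after mutation at n, and
      -- from there on they develop as on the other path.
      Y-state : ∀ t d → t ℕ.+ d ≡ K′ → State a D (alternate t) (alternate (suc t))
        (λ i → u i d) (λ i → u i (suc d)) (v (suc t)) (v t) c₂ (orbit Q (2 ℕ.+ t))
      Y-state zero    d refl = State-subst
        (mutate-P-neg 0≤a Y₁-state (λ i → 2≤⇒0≤ (2≤u i K′)) v₀≤0)
        (λ i → W-back a (u i K′) (u i (suc K′))) (λ _ → refl) (neg-involutive _) refl (λ _ → refl)
      Y-state (suc t) d eq   = State-subst
        (mutate-P 0≤a (Y-state t (suc d) (trans (ℕ.+-suc t d) eq))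
          (λ i → 2≤⇒0≤ (2≤u i d)) (2≤⇒0≤ (2≤v t)))
        (λ i → W-back a (u i d) (u i (suc d))) (λ _ → refl) refl refl (λ _ → refl)

      private
        module AtQ = Neighbours SQ 2≤a 2≤D (λ i → 2≤u i (suc K′)) (λ i → 2≤u i K)

        module AtX t d (eq : t ℕ.+ suc d ≡ K) =
          Neighbours (X-state t (suc d) eq) 2≤a 2≤D (λ i → 2≤u i d) (λ i → 2≤u i (suc d))

        module AtY₁ = Neighbours Y₁-state 2≤a 2≤D (λ i → 2≤u i K′) (λ i → 2≤u i (suc K′))

        module AtY t d (eq : t ℕ.+ suc d ≡ K′) =
          Neighbours (Y-state t (suc d) eq) 2≤a 2≤D (λ i → 2≤u i d) (λ i → 2≤u i (suc d))

      Q-OnTriangle : ∀ {z} → z ≢ last → OnTriangle Q z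
      Q-OnTriangle = AtQ.OnTriangle-≢last

      N-OnTriangle : ∀ {z} → z ≢ last → OnTriangle N z
      N-OnTriangle = AtX.OnTriangle-≢last 0 (suc K′) refl

      fork-off-Q : ∀ w → w ≢ last → w ≢ v₁ → Fork (μ w Q) w
      fork-off-Q w w≢last w≢v₁ = go (classify r₁₂ w) w≢last w≢v₁
        where
        2≤--v₁ = subst (+ 2 ≤_) (sym (neg-involutive _)) 2≤p₀
        Last : LastArrows (- v 1) (- v 0) s
        Last = sink 2≤s (inj₂ 2≤--v₁) (inj₁ 2≤-v₀)
        go : ∀ {w} → Class v₁ v₂ w → w ≢ last → w ≢ v₁ → Fork (μ w Q) w
        go isP       _ w≢ = contradiction refl w≢
        go isLast    w≢ _ = contradiction refl w≢
        go (isMid i) _ _  = AtQ.fork-at-mid Last (λ i → u-mono i (suc K′)) (λ i → a<u i (suc K′)) i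
        go isQ       _ _  = AtQ.fork-at-Q Last (λ i → u-mono i (suc K′)) (λ i → a<u i (suc K′))
          (λ _ → subst (+ 2 ≤_) (sym Q.pl) 2≤--v₁)
          (λ last→v₂ → contradiction (subst (+ 2 ≤_) (sym Q.ql) 2≤-v₀) (Arr-asym Q.quiv last→v₂))

      fork-off-N : ∀ w → w ≢ last → w ≢ v₁ → Fork (μ w N) w
      fork-off-N w w≢last w≢v₁ = go (classify r₁₂ w) w≢last w≢v₁
        where
        module N = State (X-state 0 K refl)
        2≤--s : ∀ i → + 2 ≤ - - s i
        2≤--s i = subst (+ 2 ≤_) (sym (neg-involutive _)) (2≤s i)
        Last : LastArrows (v 1) (v 0) (λ i → - s i)
        Last = source 2≤--s 2≤p₀ (inj₂ 2≤-v₀)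
        go : ∀ {w} → Class v₁ v₂ w → w ≢ last → w ≢ v₁ → Fork (μ w N) w
        go isP       _ w≢ = contradiction refl w≢
        go isLast    w≢ _ = contradiction refl w≢
        go (isMid i) _ _  = AtX.fork-at-mid 0 (suc K′) refl Last (λ i → u-mono i (suc K′)) (λ i → a<u i (suc K′)) i
        go isQ       _ _  = AtX.fork-at-Q 0 (suc K′) refl Last (λ i → u-mono i (suc K′)) (λ i → a<u i (suc K′))
          (λ v₂→last → contradiction (subst (+ 2 ≤_) (sym N.lq) 2≤-v₀) (Arr-asym N.quiv {v₂} {last} v₂→last))
          (λ _ i → subst (+ 2 ≤_) (sym (N.lm i)) (2≤--s i))

      module _ t d (eq : suc t ℕ.+ suc d ≡ K) where

        private
          module X = State (X-state (suc t) (suc d) eq)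
          module At = AtX (suc t) d eq
          2≤--s : ∀ i → + 2 ≤ - - s i
          2≤--s i = subst (+ 2 ≤_) (sym (neg-involutive _)) (2≤s i)

        fork-off-X : ∀ w → w ≢ alternate t → w ≢ alternate (suc t) → Fork (μ w (orbit N (suc t))) w
        fork-off-X w w≢ w≢′ = go (classify X.roles w) w≢ w≢′
          where
          Last : LastArrows (v (suc (suc t))) (v (suc t)) (λ i → - s i)
          Last = source 2≤--s (2≤v (suc t)) (inj₁ (2≤v t))
          go : ∀ {w} → Class (alternate (suc t)) (alternate t) w → w ≢ alternate t → w ≢ alternate (suc t) →
               Fork (μ w (orbit N (suc t))) w
          go isP       _ w≢ = contradiction refl w≢
          go isQ       w≢ _ = contradiction refl w≢
          go (isMid i) _ _  = At.fork-at-mid Last (λ i → u-mono i d) (λ i → a<u i d) i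
          go isLast    _ _  = At.fork-at-last-source Last 2≤--s (2≤v (suc t)) (2≤v t) (a<v t)

        NoSourceSink-X : NoSourceSink (orbit N (suc t))
        NoSourceSink-X = At.NoSourceSink-interior
          (alternate t , subst (+ 2 ≤_) (sym X.ql) (2≤v t)) (alternate (suc t) , subst (+ 2 ≤_) (sym X.lp) (2≤v (suc t)))

      fork-off-Y₁ : ∀ w → w ≢ v₁ → w ≢ v₂ → Fork (μ w (orbit Q 1)) w
      fork-off-Y₁ w w≢v₁ w≢v₂ = go (classify r₂₁ w) w≢v₁ w≢v₂
        where
        2≤--v₁ = subst (+ 2 ≤_) (sym (neg-involutive _)) 2≤p₀
        Last : LastArrows (v 0) (- v 1) c₁
        Last = sink 2≤c₁ (inj₂ 2≤-v₀)
          (inj₂ (2≤--v₁ , λ i → subst (_< c₁ i) (sym (neg-involutive _)) (proj₂ (D₁ i))))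
        go : ∀ {w} → Class v₂ v₁ w → w ≢ v₁ → w ≢ v₂ → Fork (μ w (orbit Q 1)) w
        go isP       _ w≢ = contradiction refl w≢
        go isQ       w≢ _ = contradiction refl w≢
        go (isMid i) _ _  = AtY₁.fork-at-mid Last (λ i → u-mono i K′) (λ i → a<u i K′) i
        go isLast    _ _  = AtY₁.fork-at-last-first Last 2≤c₁ (λ i → proj₁ (D₁ i)) 2≤-v₀ 2≤--v₁

      fork-off-Y : ∀ t d → t ℕ.+ suc d ≡ K′ → ∀ w → w ≢ alternate (suc t) → w ≢ alternate t →
        Fork (μ w (orbit Q (2 ℕ.+ t))) w
      fork-off-Y t d eq w w≢ w≢′ = go (classify (alternate-roles t) w) w≢ w≢′
        where
        module At = AtY t d eq
        Last : ∀ t → t ℕ.+ suc d ≡ K′ → LastArrows (v (suc t)) (v t) c₂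
        -- Since `v 0` is negative, n still points to both 1 and 2 in `orbit Q 2`.
        Last zero    _ = sink 2≤c₂ (inj₁ (2≤v 0)) (inj₂ (2≤-v₀ , λ i → proj₂ (D₂ i)))
        Last (suc t) _ = sink 2≤c₂ (inj₁ (2≤v (suc t))) (inj₁ (2≤v t))
        go : ∀ {w} → Class (alternate t) (alternate (suc t)) w → w ≢ alternate (suc t) → w ≢ alternate t →
             Fork (μ w (orbit Q (2 ℕ.+ t))) w
        go isP       _ w≢ = contradiction refl w≢
        go isQ       w≢ _ = contradiction refl w≢
        go (isMid i) _ _  = At.fork-at-mid (Last t eq) (λ i → u-mono i d) (λ i → a<u i d) i
        go isLast    _ _  = at-last t eq
          where
          at-last : ∀ t (eq : t ℕ.+ suc d ≡ K′) → Fork (μ last (orbit Q (2 ℕ.+ t))) last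
          at-last zero    eq = AtY.fork-at-last-second 0 d eq (Last 0 eq) 2≤c₂
            (λ i → subst (λ e → u i (suc e) < c₂ i) (sym eq) (proj₁ (D₂ i))) (2≤v 0) 2≤-v₀
          at-last (suc t) eq = AtY.fork-at-last-later (suc t) d eq (Last (suc t) eq) 2≤c₂
            (2≤v (suc t)) (2≤v t) (a<v t)

      NoSourceSink-Y : ∀ t → suc t ℕ.≤ K → NoSourceSink (orbit Q (suc t))
      NoSourceSink-Y zero    _ = AtY₁.NoSourceSink-interior
          (v₂ , subst (+ 2 ≤_) (sym Y.pl) 2≤-v₀) (v₁ , subst (+ 2 ≤_) (sym Y.lq) 2≤--v₁)
        where
        module Y = State Y₁-state
        2≤--v₁ = subst (+ 2 ≤_) (sym (neg-involutive _)) 2≤p₀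
      NoSourceSink-Y (suc t) t≤ = go (K′ ℕ.∸ t) (ℕ.m+[n∸m]≡n (ℕ.≤-pred (ℕ.≤-pred t≤)))
        where
        go : ∀ d → t ℕ.+ d ≡ K′ → NoSourceSink (orbit Q (2 ℕ.+ t))
        go zero    eq = NoSourceSink-end (Y-state t 0 eq) 2≤a
            (λ i → subst (+ 2 ≤_) (sym (neg-involutive _)) (2≤x i)) (2≤v t) 2≤c₂
            (mid zero , subst (+ 2 ≤_) (sym (State.qm (Y-state t 0 eq) zero)) (2≤y zero))
        go (suc d) eq = AtY.NoSourceSink-interior t d eq
            (mid zero , subst (+ 2 ≤_) (sym (Y.ml zero)) (2≤c₂ zero)) (alternate t , subst (+ 2 ≤_) (sym Y.lp) (2≤v t))
          where module Y = State (Y-state t (suc d) eq)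

      NoSourceSink-X′ : ∀ t → suc t ℕ.< K → NoSourceSink (orbit N (suc t))
      NoSourceSink-X′ t t< = NoSourceSink-X t (K ℕ.∸ suc (suc t))
        (trans (ℕ.+-suc (suc t) _) (ℕ.m+[n∸m]≡n t<))

      R : Mat (4 ℕ.+ m)
      R = orbit N K

      R-state : State a D v₁ v₂ (λ i → u i 0) (λ i → u i 1) (v (suc K)) (v K) (λ i → - s i) R
      R-state = subst₂ (λ p q → State a D p q _ _ _ _ _ R) (alternate-even k′) (alternate-odd k′)
        (X-state K 0 (ℕ.+-identityʳ K))

      -- The sink is n - 1: on 1, ..., n - 1 the weights are unwound back to those of `R̃`, and n
      -- points to 3, ..., n - 1.
      R-has-sink : ¬ NoSourceSink R
      R-has-sink noSS with proj₂ (noSS (mid (fromℕ m)))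
      ... | z , from = go (classify R.roles z) from
        where
        module R = State R-state
        nonpos : ∀ {x y} → x ≡ - y → + 0 ≤ y → x ≤ + 0
        nonpos refl p = neg≤0 p
        go : ∀ {z} → Class v₁ v₂ z → ¬ Arr R (mid (fromℕ m)) z
        go isP       = ¬2≤0 (nonpos (R.mp _) (2≤⇒0≤ (2≤x _)))
        go isQ       = ¬2≤0 (nonpos (R.mq _) (2≤⇒0≤ (2≤y _)))
        go isLast    = ¬2≤0 (nonpos (R.ml _) (2≤⇒0≤ (2≤s _)))
        go (isMid j) mid→j with ℕ.m≤n⇒m<n∨m≡n (≤fromℕ j)
        ... | inj₁ j<  = contradiction (subst (+ 2 ≤_) (sym (R.mm j _)) (2≤D j<))
              (Arr-asym R.quiv {mid (fromℕ m)} {mid j} mid→j)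
        ... | inj₂ eq = Arr⇒≢ R.quiv mid→j (cong mid (toℕ-injective (sym eq)))

      X-path Y-path : ℕ → Mat (4 ℕ.+ m)
      X-path zero    = Q
      X-path (suc t) = orbit N t
      Y-path         = orbit Q

      private
        X-dir : ℕ → Fin (4 ℕ.+ m)
        X-dir zero    = last
        X-dir (suc t) = alternate t

      module _ {c : ℕ → Mat (4 ℕ.+ m)} (walk : ReducedWalk Q c) (start : Iso Q (c 0)) where

        first-step : ∀ {w} → Iso (μ w Q) (c 1) → w ≡ last ⊎ w ≡ v₁
        first-step {w} next with w ≟ last | w ≟ v₁
        ... | yes eq | _      = inj₁ eq
        ... | no _   | yes eq = inj₂ eq
        ... | no w≢  | no w≢′ = contradiction (Iso-trans (≋⇒Iso (μ-involutive w Q)) start)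
              (fork-leaves walk Q-has-sink 0 (fork-off-Q w w≢ w≢′) next)

        follows-X : Iso N (c 1) → ∀ t → t ℕ.≤ suc K → Iso (X-path t) (c t)
        follows-X = follows-path walk Q-has-sink X-path X-dir (suc K) quiv step fork start
          where
          quiv : ∀ t → IsQuiver (X-path t)
          quiv zero    = Q.quiv
          quiv (suc t) = orbit-quiver (μ-quiver last Q.quiv) t
          step : ∀ t → X-path (suc t) ≡ μ (X-dir t) (X-path t)
          step zero    = refl
          step (suc t) = refl
          fork : ∀ t → suc t ℕ.< suc K → ∀ w → w ≢ X-dir t → w ≢ X-dir (suc t) → Fork (μ w (orbit N t)) w
          fork zero    _  w w≢ w≢′ = fork-off-N w w≢ w≢′
          fork (suc t) t< w w≢ w≢′ = fork-off-X t (K ℕ.∸ suc (suc t))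
            (trans (ℕ.+-suc (suc t) _) (ℕ.m+[n∸m]≡n (ℕ.≤-pred t<))) w w≢ w≢′

        follows-Y : Iso (orbit Q 1) (c 1) → ∀ t → t ℕ.≤ K → Iso (Y-path t) (c t)
        follows-Y = follows-path walk Q-has-sink Y-path alternate K (orbit-quiver Q.quiv) (λ _ → refl) fork start
          where
          fork : ∀ t → suc t ℕ.< K → ∀ w → w ≢ alternate t → w ≢ alternate (suc t) → Fork (μ w (orbit Q (suc t))) w
          fork zero    _  w w≢ w≢′ = fork-off-Y₁ w w≢ w≢′
          fork (suc t) t< w w≢ w≢′ = fork-off-Y t (K′ ℕ.∸ suc t)
            (trans (ℕ.+-suc t _) (ℕ.m+[n∸m]≡n (ℕ.≤-pred (ℕ.≤-pred t<)))) w w≢ w≢′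

      module _ {c c′ : ℕ → Mat (4 ℕ.+ m)} (walk : ReducedWalk Q c) (walk′ : ReducedWalk Q c′)
        (start : Iso Q (c 0)) (start′ : Iso Q (c′ 0)) (next : Iso N (c 1)) (next′ : Iso (orbit Q 1) (c′ 1))
        {ℓ} (meet : ∀ i j → i ℕ.+ j ≡ ℓ → c i ≡ c′ j) where

        private
          X : ∀ t → t ℕ.≤ suc K → Iso (X-path t) (c t)
          X = follows-X walk start next
          Y : ∀ t → t ℕ.≤ K → Iso (Y-path t) (c′ t)
          Y = follows-Y walk′ start′ next′

          separate : ∀ i j → i ℕ.+ j ≡ ℓ → i ℕ.≤ suc K → j ℕ.≤ K → Iso (X-path i) (Y-path j)
          separate i j eq i≤ j≤ = Iso-trans (X i i≤)
            (subst (λ z → Iso z (Y-path j)) (sym (meet i j eq)) (Iso-sym (Y j j≤)))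

        -- Which quivers would coincide depends on `ℓ`: for `ℓ ≤ K` an inner quiver of `X-path` and
        -- `Q`; for `ℓ = K + 1` the quivers `N` and `Y-path K`; up to `2K + 1` the end `R` of
        -- `X-path` and `Y-path (ℓ - K - 1)`.
        length-bound : 2 ℕ.≤ ℓ → suc (K ℕ.+ K) ℕ.< ℓ
        length-bound 2≤ℓ with ℕ.<-cmp ℓ (suc K)
        ... | tri< ℓ< _ _ = contradiction
              (NoSourceSink-Iso (separate ℓ 0 (ℕ.+-identityʳ ℓ) (ℕ.<⇒≤ ℓ<) z≤n) (quiver ℓ) (interior ℓ 2≤ℓ ℓ<))
              Q-has-sink
          where
          quiver : ∀ t → IsQuiver (X-path t)
          quiver zero    = Q.quiv
          quiver (suc t) = orbit-quiver (μ-quiver last Q.quiv) t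
          interior : ∀ t → 2 ℕ.≤ t → t ℕ.< suc K → NoSourceSink (X-path t)
          interior (suc (suc t)) (s≤s (s≤s _)) t< = NoSourceSink-X′ t (ℕ.≤-pred t<)
        ... | tri≈ _ refl _ = contradiction
              (NoSourceSink-Iso (Iso-sym (separate 1 K refl (s≤s z≤n) ℕ.≤-refl)) (orbit-quiver Q.quiv K)
                (NoSourceSink-Y (suc K′) ℕ.≤-refl))
              N-has-source
        ... | tri> _ _ K< with suc (K ℕ.+ K) ℕ.<? ℓ
        ...   | yes bound = bound
        ...   | no ¬bound = contradiction (j≢0 (ℓ ℕ.∸ suc K) eq) R-has-sink
          where
          eq : suc K ℕ.+ (ℓ ℕ.∸ suc K) ≡ ℓ
          eq = ℕ.m+[n∸m]≡n (ℕ.<⇒≤ K<)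
          j≢0 : ∀ j → suc K ℕ.+ j ≡ ℓ → NoSourceSink R
          j≢0 zero    e = contradiction K< (ℕ.<-irrefl (trans (sym (ℕ.+-identityʳ (suc K))) e))
          j≢0 (suc j) e = NoSourceSink-Iso (Iso-sym (separate (suc K) (suc j) e ℕ.≤-refl j≤))
              (orbit-quiver Q.quiv (suc j))
              (NoSourceSink-Y j j≤)
            where
            j≤ : suc j ℕ.≤ K
            j≤ = ℕ.+-cancelˡ-≤ (suc K) (suc j) K (subst (ℕ._≤ suc (K ℕ.+ K)) (sym e) (ℕ.≮⇒≥ ¬bound))

      -- The two directions leave `Q` through different classes, so one of them starts with `N` and
      -- the other with `orbit Q 1`.
      two-way-bound : ∀ {c c′ : ℕ → Mat (4 ℕ.+ m)} → ReducedWalk Q c → ReducedWalk Q c′ →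
        Iso Q (c 0) → Iso Q (c′ 0) → (∀ {A} → Iso A (c 1) → ¬ Iso A (c′ 1)) →
        ∀ {ℓ} → (∀ i j → i ℕ.+ j ≡ ℓ → c i ≡ c′ j) → 2 ℕ.≤ ℓ → suc (K ℕ.+ K) ℕ.< ℓ
      two-way-bound walk walk′ start start′ turns meet 2≤ℓ
        with ReducedWalk.adjacent walk 0 Q.quiv start | ReducedWalk.adjacent walk′ 0 Q.quiv start′
      ... | w , next | w′ , next′ with first-step walk start next | first-step walk′ start′ next′
      ...   | inj₁ refl | inj₁ refl = contradiction next′ (turns next)
      ...   | inj₂ refl | inj₂ refl = contradiction next′ (turns next)
      ...   | inj₁ refl | inj₂ refl = length-bound walk walk′ start start′ next next′ meet 2≤ℓ
      ...   | inj₂ refl | inj₁ refl = length-bound walk′ walk start′ start next′ next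
              (λ i j eq → sym (meet j i (trans (ℕ.+-comm j i) eq))) 2≤ℓ

  -- The sink mutations at n - 1, …, 3

  mids : ∀ {m} → List (Fin (4 ℕ.+ m))
  mids = tabulate mid

  downFrom-mids : ∀ m → downFrom (3 ℕ.+ m) ≡ reverse mids ++ v₂ ∷ v₁ ∷ []
  downFrom-mids m = begin
    reverse (v₁ ∷ v₂ ∷ map inject₁ (tabulate {n = suc m} (λ i → suc (suc i))))
      ≡⟨ cong (λ xs → reverse (v₁ ∷ v₂ ∷ xs)) (map-tabulate {n = suc m} (λ i → suc (suc i)) inject₁) ⟩
    reverse (v₁ ∷ v₂ ∷ mids)
      ≡⟨ unfold-reverse v₁ (v₂ ∷ mids) ⟩
    reverse (v₂ ∷ mids) ++ v₁ ∷ []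
      ≡⟨ cong (_++ v₁ ∷ []) (unfold-reverse v₂ mids) ⟩
    (reverse mids ++ v₂ ∷ []) ++ v₁ ∷ []
      ≡⟨ ++-assoc (reverse mids) (v₂ ∷ []) (v₁ ∷ []) ⟩
    reverse mids ++ v₂ ∷ v₁ ∷ [] ∎
    where open ≡-Reasoning

  -- To be used with `E` saying that an edge is not the one between `Q` and `N`.
  data Steps {n} (E : Mat n → Mat n → Set) : List (Fin n) → Mat n → Set where
    []  : ∀ {B} → Steps E [] B
    _∷_ : ∀ {k ks B} → E B (μ k B) → Steps E ks (μ k B) → Steps E (k ∷ ks) B

  Steps-++ : ∀ {E : Mat n → Mat n → Set} {ks ls B} → Steps E ks B → Steps E ls (μs ks B) → Steps E (ks ++ ls) B
  Steps-++ []       t = t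
  Steps-++ (e ∷ es) t = e ∷ Steps-++ es t

  module SinkSequence {m} (a : ℤ) {D : Fin (suc m) → Fin (suc m) → ℤ} (x y s : Fin (suc m) → ℤ) (f∞ g∞ : ℤ)
    (2≤D : ∀ {i j} → i Fin.< j → + 2 ≤ D i j)
    (2≤x : ∀ i → + 2 ≤ x i) (2≤y : ∀ i → + 2 ≤ y i) (2≤s : ∀ i → + 2 ≤ s i) where

    -- θ is the number of vertices mid i that have not been mutated yet.
    sgn : ℕ → Fin (suc m) → Sgn
    sgn θ i = if does (θ ℕ.≤? toℕ i) then pos else neg

    sgn-pos : ∀ {θ i} → θ ℕ.≤ toℕ i → sgn θ i ≡ pos
    sgn-pos {θ} {i} p rewrite dec-true (θ ℕ.≤? toℕ i) p = refl

    sgn-neg : ∀ {θ i} → toℕ i ℕ.< θ → sgn θ i ≡ neg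
    sgn-neg {θ} {i} p rewrite dec-false (θ ℕ.≤? toℕ i) (ℕ.<⇒≱ p) = refl

    sgn-suc : ∀ {θ i} → toℕ i ≢ θ → sgn θ i ≡ sgn (suc θ) i
    sgn-suc {θ} {i} ≢θ with ℕ.<-cmp (toℕ i) θ
    ... | tri< i<θ _ _ = trans (sgn-neg {θ} {i} i<θ) (sym (sgn-neg {suc θ} {i} (ℕ.m≤n⇒m≤1+n i<θ)))
    ... | tri≈ _ eq _  = contradiction eq ≢θ
    ... | tri> _ _ θ<i = trans (sgn-pos {θ} {i} (ℕ.<⇒≤ θ<i)) (sym (sgn-pos {suc θ} {i} θ<i))

    -- An arrow between `mid i` and `mid j` is reversed by each of their two mutations, hence the
    -- product of two signs; both are `neg` at the start and `pos` at the end.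
    IsS : ℕ → Mat (4 ℕ.+ m) → Set
    IsS θ = State a (λ i j → sgn θ i · (sgn θ j · D i j)) v₁ v₂
      (λ i → sgn θ i · x i) (λ i → - (sgn θ i · y i)) f∞ g∞ (λ i → sgn θ i · s i)

    module _ {B} (S : State a D v₁ v₂ (λ i → - x i) y f∞ g∞ (λ i → - s i) B) where
      open State S

      S-start : IsS (suc m) B
      S-start = record
        { roles = roles ; quiv = quiv ; pq = pq ; lp = lp ; ql = ql
        ; mp = λ i → trans (mp i) (cong (_· x i) (sym (unmoved i)))
        ; qm = λ i → trans (qm i) (trans (sym (neg-involutive _)) (cong (λ σ → - (σ · y i)) (sym (unmoved i))))
        ; mm = λ i j → trans (mm i j) (trans (sym (neg-involutive _))
            (cong₂ (λ σ τ → σ · (τ · D i j)) (sym (unmoved i)) (sym (unmoved j))))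
        ; ml = λ i → trans (ml i) (cong (_· s i) (sym (unmoved i)))
        }
        where
        unmoved : ∀ i → sgn (suc m) i ≡ neg
        unmoved i = sgn-neg (toℕ<n i)

    S-end : ∀ {B} → IsS 0 B → State a D v₁ v₂ x (λ i → - y i) f∞ g∞ s B
    -- `sgn 0 i` computes to `pos`, so the fields fit as they are.
    S-end S = record { State S }

    module _ {θ B} (S : IsS (suc θ) B) {i₀ : Fin (suc m)} (i₀≡θ : toℕ i₀ ≡ θ) where
      open State S

      private
        is-neg : sgn (suc θ) i₀ ≡ neg
        is-neg = sgn-neg {suc θ} {i₀} (s≤s (ℕ.≤-reflexive i₀≡θ))

        is-pos : sgn θ i₀ ≡ pos
        is-pos = sgn-pos {θ} {i₀} (ℕ.≤-reflexive (sym i₀≡θ))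

        same : ∀ {i} → i ≢ i₀ → sgn θ i ≡ sgn (suc θ) i
        same {i} i≢ = sgn-suc {θ} {i} (λ eq → i≢ (toℕ-injective (trans eq (sym i₀≡θ))))

        opposite : ∀ z → - (sgn (suc θ) i₀ · z) ≡ sgn θ i₀ · z
        opposite z rewrite is-neg | is-pos = neg-involutive z

        nonneg : ∀ {x y} → x ≡ y → + 2 ≤ y → + 0 ≤ x
        nonneg refl = 2≤⇒0≤

        into : ∀ z → + 0 ≤ B z (mid i₀)
        into z = go (classify roles z)
          where
          go : ∀ {z} → Class v₁ v₂ z → + 0 ≤ B z (mid i₀)
          go isP       = nonneg (trans (pm i₀) (trans (opposite (x i₀)) (cong (_· x i₀) is-pos))) (2≤x i₀)
          go isQ       = nonneg (trans (qm i₀) (trans (opposite (y i₀)) (cong (_· y i₀) is-pos))) (2≤y i₀)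
          go isLast    = nonneg (trans (lm i₀) (trans (opposite (s i₀)) (cong (_· s i₀) is-pos))) (2≤s i₀)
          go (isMid i) with <-cmp i i₀
          ... | tri< i<i₀ _ _ = nonneg (trans (mm i i₀) (trans
                (cong₂ (λ σ τ → σ · (τ · D i i₀))
                  (sgn-neg {suc θ} {i} (ℕ.m≤n⇒m≤1+n (subst (toℕ i ℕ.<_) i₀≡θ i<i₀))) is-neg)
                (neg-involutive _))) (2≤D i<i₀)
          ... | tri≈ _ refl _ = ≤-reflexive (sym (diagonal-unique {y = + 0} (quiv _ _) refl))
          ... | tri> _ _ i₀<i = nonneg (trans (quiv _ _) (trans (cong -_ (trans (mm i₀ i)
                (cong₂ (λ σ τ → σ · (τ · D i₀ i)) is-neg (sgn-pos {suc θ} {i} (subst (ℕ._< toℕ i) i₀≡θ i₀<i)))))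
                (neg-involutive _))) (2≤D i₀<i)

        keep : ∀ {u v} → u ≢ mid i₀ → v ≢ mid i₀ → μ (mid i₀) B u v ≡ B u v
        keep {u} {v} u≢ v≢ = μ-+- B u≢ v≢ (into u) (subst (_≤ + 0) (sym (quiv (mid i₀) v)) (neg≤0 (into v)))

        other : ∀ {i} → i ≢ i₀ → mid i ≢ mid i₀
        other i≢ = i≢ ∘ mid-injective

      S-step : IsS θ (μ (mid i₀) B)
      S-step = record
        { roles = roles ; quiv = μ-quiver (mid i₀) quiv
        ; pq = trans (keep (λ ()) (λ ())) pq
        ; lp = trans (keep (mid≢last ∘ sym) (λ ())) lp
        ; ql = trans (keep (λ ()) (mid≢last ∘ sym)) ql
        ; mp = mp′ ; qm = qm′ ; mm = mm′ ; ml = ml′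
        }
        where
        mp′ : ∀ i → μ (mid i₀) B (mid i) v₁ ≡ sgn θ i · x i
        mp′ i with i ≟ i₀
        ... | yes refl = trans (μ-source (mid i₀) B v₁) (trans (cong -_ (mp i₀)) (opposite (x i₀)))
        ... | no i≢    = trans (keep (other i≢) (λ ())) (trans (mp i) (cong (_· x i) (sym (same i≢))))
        qm′ : ∀ i → μ (mid i₀) B v₂ (mid i) ≡ - (sgn θ i · y i)
        qm′ i with i ≟ i₀
        ... | yes refl = trans (μ-target (mid i₀) B v₂) (cong -_ (trans (qm i₀) (opposite (y i₀))))
        ... | no i≢    = trans (keep (λ ()) (other i≢)) (trans (qm i) (cong (λ σ → - (σ · y i)) (sym (same i≢))))
        ml′ : ∀ i → μ (mid i₀) B (mid i) last ≡ sgn θ i · s i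
        ml′ i with i ≟ i₀
        ... | yes refl = trans (μ-source (mid i₀) B last) (trans (cong -_ (ml i₀)) (opposite (s i₀)))
        ... | no i≢    = trans (keep (other i≢) (mid≢last ∘ sym)) (trans (ml i) (cong (_· s i) (sym (same i≢))))
        mm′ : ∀ i j → μ (mid i₀) B (mid i) (mid j) ≡ sgn θ i · (sgn θ j · D i j)
        mm′ i j with i ≟ i₀ | j ≟ i₀
        ... | yes refl | yes refl = trans
                (diagonal-unique (μ-quiver (mid i₀) quiv (mid i₀) (mid i₀)) (quiv (mid i₀) (mid i₀)))
                (trans (mm i₀ i₀) (twice (sgn (suc θ) i₀) (sgn θ i₀) (D i₀ i₀)))
          where
          twice : ∀ σ τ z → σ · (σ · z) ≡ τ · (τ · z)
          twice σ τ z = trans (·-involutive σ z) (sym (·-involutive τ z))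
        ... | yes refl | no j≢ = trans (μ-source (mid i₀) B (mid j)) (trans (cong -_ (mm i₀ j))
                (trans (opposite _) (cong (λ τ → sgn θ i₀ · (τ · D i₀ j)) (sym (same j≢)))))
        ... | no i≢ | yes refl = trans (μ-target (mid i₀) B (mid i)) (trans (cong -_ (mm i i₀))
                (trans (sym (·-neg (sgn (suc θ) i) _)) (cong₂ _·_ (sym (same i≢)) (opposite (D i i₀)))))
        ... | no i≢ | no j≢ = trans (keep (other i≢) (other j≢)) (trans (mm i j)
                (cong₂ (λ σ τ → σ · (τ · D i j)) (sym (same i≢)) (sym (same j≢))))

    module _ {E : Mat (4 ℕ.+ m) → Mat (4 ℕ.+ m) → Set}
      (edge : ∀ {θ B B′} → θ ℕ.< suc m → IsS (suc θ) B → IsS θ B′ → E B B′) {B} (S : IsS (suc m) B) where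

      private
        -- `g` embeds the `c` letters as the largest indices, because the reversed list mutates
        -- these first.
        descend : ∀ c θ (g : Fin c → Fin (suc m)) → (∀ i → toℕ (g i) ≡ θ ℕ.+ toℕ i) → θ ℕ.+ c ≡ suc m →
          let ks = reverse (tabulate (mid ∘ g)) in IsS θ (μs ks B) × Steps E ks B
        descend zero    θ g g≡ eq = subst (λ θ → IsS θ B) (trans (sym eq) (ℕ.+-identityʳ θ)) S , []
        descend (suc c) θ g g≡ eq
          with descend c (suc θ) (g ∘ suc) (λ i → trans (g≡ (suc i)) (ℕ.+-suc θ (toℕ i))) (trans (sym (ℕ.+-suc θ c)) eq)
        ... | S′ , steps rewrite unfold-reverse (mid (g zero)) (tabulate (mid ∘ g ∘ suc))
                               | μs-++ (reverse (tabulate (mid ∘ g ∘ suc))) (mid (g zero) ∷ []) B =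
          S″ , Steps-++ steps (edge (ℕ.m+n≤o⇒m≤o (suc θ) (ℕ.≤-reflexive (trans (sym (ℕ.+-suc θ c)) eq))) S′ S″ ∷ [])
          where
          S″ : IsS θ (μ (mid (g zero)) (μs (reverse (tabulate (mid ∘ g ∘ suc))) B))
          S″ = S-step S′ (trans (g≡ zero) (ℕ.+-identityʳ θ))

      S-sequence : IsS 0 (μs (reverse mids) B) × Steps E (reverse mids) B
      S-sequence = descend (suc m) 0 (λ i → i) (λ _ → refl) refl

    module _ {θ B} (S : IsS θ B) where
      open State S

      private
        -- All arrows go from the moved vertices, in order, through the block 1, 2, n, to the unmoved ones.
        rank : ∀ {z} → Class {m} v₁ v₂ z → ℕ
        rank isP       = suc m
        rank isQ       = suc m
        rank isLast    = suc m
        rank (isMid i) = if does (θ ℕ.≤? toℕ i) then toℕ i else 2 ℕ.+ m ℕ.+ toℕ i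

        rank-moved : ∀ {i} → θ ℕ.≤ toℕ i → rank (isMid i) ≡ toℕ i
        rank-moved {i} p rewrite dec-true (θ ℕ.≤? toℕ i) p = refl

        rank-unmoved : ∀ {i} → toℕ i ℕ.< θ → rank (isMid i) ≡ 2 ℕ.+ m ℕ.+ toℕ i
        rank-unmoved {i} p rewrite dec-false (θ ℕ.≤? toℕ i) (ℕ.<⇒≱ p) = refl

        data Side (i : Fin (suc m)) : Set where
          moved   : θ ℕ.≤ toℕ i → sgn θ i ≡ pos → rank (isMid i) ≡ toℕ i → Side i
          unmoved : toℕ i ℕ.< θ → sgn θ i ≡ neg → rank (isMid i) ≡ 2 ℕ.+ m ℕ.+ toℕ i → Side i

        side : ∀ i → Side i
        side i with ℕ.≤-<-connex θ (toℕ i)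
        ... | inj₁ p = moved p (sgn-pos {θ} {i} p) (rank-moved p)
        ... | inj₂ p = unmoved p (sgn-neg {θ} {i} p) (rank-unmoved p)

        absurd : ∀ {b z : ℤ} {A : Set} → + 2 ≤ b → b ≡ - z → + 2 ≤ z → A
        absurd p eq q = contradiction q (2≤-asym eq p)

        same-side : ∀ {i j} → sgn θ i ≡ sgn θ j → Arr B (mid i) (mid j) → toℕ i ℕ.< toℕ j
        same-side {i} {j} eq i→j with <-cmp i j
        ... | tri< i<j _ _  = i<j
        ... | tri≈ _ refl _ = contradiction i→j (Arr-irrefl quiv)
        ... | tri> _ _ j<i  = contradiction (subst (+ 2 ≤_) (sym entry) (2≤D j<i)) (Arr-asym quiv {mid i} {mid j} i→j)
          where
          entry : B (mid j) (mid i) ≡ D j i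
          entry = trans (mm j i) (trans (cong (λ σ → σ · (sgn θ i · D j i)) (sym eq)) (·-involutive (sgn θ i) (D j i)))

        into-unmoved : ∀ (j : Fin (suc m)) → suc m ℕ.≤ 2 ℕ.+ m ℕ.+ toℕ j
        into-unmoved j = ℕ.≤-trans (ℕ.n≤1+n (suc m)) (ℕ.m≤m+n (2 ℕ.+ m) (toℕ j))

        from-mid : ∀ i {v} (v′ : Class {m} v₁ v₂ v) → Arr B (mid i) v → rank (isMid i) ℕ.< rank v′
        from-mid i v′ t with side i
        from-mid i isP       t | moved _ _ eq   rewrite eq = toℕ<n i
        from-mid i isQ       t | moved _ _ eq   rewrite eq = toℕ<n i
        from-mid i isLast    t | moved _ _ eq   rewrite eq = toℕ<n i
        from-mid i isP       t | unmoved _ σ _ = absurd t (trans (mp i) (cong (_· x i) σ)) (2≤x i)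
        from-mid i isQ       t | unmoved _ σ _ = absurd t
          (trans (mq i) (trans (neg-involutive _) (cong (_· y i) σ))) (2≤y i)
        from-mid i isLast    t | unmoved _ σ _ = absurd t (trans (ml i) (cong (_· s i) σ)) (2≤s i)
        from-mid i (isMid j) t | moved _ σ eq with side j
        ... | moved _ τ eq′   rewrite eq | eq′ = same-side (trans σ (sym τ)) t
        ... | unmoved _ _ eq′ rewrite eq | eq′ = ℕ.<-≤-trans (toℕ<n i) (into-unmoved j)
        from-mid i (isMid j) t | unmoved i<θ σ eq with side j
        ... | moved θ≤j τ _   = absurd t (trans (mm i j) (cong₂ (λ σ τ → σ · (τ · D i j)) σ τ))
                                  (2≤D (ℕ.<-≤-trans i<θ θ≤j))
        ... | unmoved _ τ eq′ rewrite eq | eq′ = ℕ.+-monoʳ-< (2 ℕ.+ m) (same-side (trans σ (sym τ)) t)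

        into-mid : ∀ j {u} (u′ : Class {m} v₁ v₂ u) → Arr B u (mid j) → rank u′ ℕ.≤ rank (isMid j)
        into-mid j (isMid i) t = ℕ.<⇒≤ (from-mid i (isMid j) t)
        into-mid j u′ t with side j
        into-mid j isP    t | unmoved _ _ eq rewrite eq = into-unmoved j
        into-mid j isQ    t | unmoved _ _ eq rewrite eq = into-unmoved j
        into-mid j isLast t | unmoved _ _ eq rewrite eq = into-unmoved j
        into-mid j isP    t | moved _ σ _ = absurd t (trans (pm j) (cong (λ σ → - (σ · x j)) σ)) (2≤x j)
        into-mid j isQ    t | moved _ σ _ = absurd t (trans (qm j) (cong (λ σ → - (σ · y j)) σ)) (2≤y j)
        into-mid j isLast t | moved _ σ _ = absurd t (trans (lm j) (cong (λ σ → - (σ · s j)) σ)) (2≤s j)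
        into-mid j (isMid i) t | _ = ℕ.<⇒≤ (from-mid i (isMid j) t)

        Arr-rank : ∀ {u v} (u′ : Class {m} v₁ v₂ u) (v′ : Class v₁ v₂ v) → Arr B u v → rank u′ ℕ.≤ rank v′
        Arr-rank (isMid i) v′        t = ℕ.<⇒≤ (from-mid i v′ t)
        Arr-rank u′        (isMid j) t = into-mid j u′ t
        Arr-rank isP       isP       _ = ℕ.≤-refl
        Arr-rank isP       isQ       _ = ℕ.≤-refl
        Arr-rank isP       isLast    _ = ℕ.≤-refl
        Arr-rank isQ       isP       _ = ℕ.≤-refl
        Arr-rank isQ       isQ       _ = ℕ.≤-refl
        Arr-rank isQ       isLast    _ = ℕ.≤-refl
        Arr-rank isLast    isP       _ = ℕ.≤-refl
        Arr-rank isLast    isQ       _ = ℕ.≤-refl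
        Arr-rank isLast    isLast    _ = ℕ.≤-refl

      -- Ranks never fall along an arrow and rise strictly along those leaving `mid i`.
      mid-not-OnTriangle : ∀ i → ¬ OnTriangle B (mid i)
      mid-not-OnTriangle i (u , v , i→u , u→v , v→i) = ℕ.<-irrefl refl
          (ℕ.<-≤-trans (from-mid i u′ i→u) (ℕ.≤-trans (Arr-rank u′ v′ u→v) (into-mid i v′ v→i)))
        where
        u′ = classify roles u
        v′ = classify roles v

  -- Lying on an oriented triangle is invariant, and n is the only vertex of `B` that may fail to,
  -- so `w` can only correspond to n.
  off-triangle-match : ∀ {A B : Mat (4 ℕ.+ m)} (φ : Iso A B) → IsQuiver A → ∀ {w} → ¬ OnTriangle A w →
    (∀ {z} → z ≢ last → OnTriangle B z) → Iso.σ φ ⟨$⟩ʳ last ≡ w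
  off-triangle-match φ quiv {w} off on with (Iso.σ φ ⟨$⟩ˡ w) ≟ last
  ... | yes eq = trans (cong (Iso.σ φ ⟨$⟩ʳ_) (sym eq)) (Perm.inverseʳ (Iso.σ φ))
  ... | no ne  = contradiction (subst (OnTriangle _) (Perm.inverseʳ (Iso.σ φ)) (OnTriangle-Iso φ quiv _ (on ne))) off

  -- Cycles of Γ and parity of an edge

  module Cycles {n} {Q : Mat n} {ℓ} {c : ℕ → Mat n} (C : IsCycle Q ℓ c) where
    open IsCycle C

    Adj⇒μ : ∀ {u v X : Mat n} → Adj u v → Iso X u → ∃ λ k → Iso (μ k X) v
    Adj⇒μ {X = X} (A , B , k , u≅A , v≅B , e) φ = Iso.σ X≃A ⟨$⟩ʳ k ,
        Iso-trans (Iso-μ X≃A k) (Iso-trans (≋⇒Iso (toB e)) (Iso-sym (≅⇒Iso v≅B)))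
      where
      X≃A = Iso-trans φ (≅⇒Iso u≅A)
      toB : (B ≋ μ k A) ⊎ (A ≋ μ k B) → μ k A ≋ B
      toB (inj₁ e) = ≋-sym e
      toB (inj₂ e) = ≋-trans (μ-cong k e) (μ-involutive k B)

    Adj-sym : ∀ {u v : Mat n} → Adj u v → Adj v u
    Adj-sym (A , B , k , u≅A , v≅B , inj₁ e) = B , A , k , v≅B , u≅A , inj₂ e
    Adj-sym (A , B , k , u≅A , v≅B , inj₂ e) = B , A , k , v≅B , u≅A , inj₁ e

    periodic* : ∀ i j → c (i ℕ.+ j ℕ.* ℓ) ≡ c i
    periodic* i zero    = cong c (ℕ.+-identityʳ i)
    periodic* i (suc j) = trans (cong c (rearrange i j ℓ)) (trans (periodic (i ℕ.+ j ℕ.* ℓ)) (periodic* i j))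
      where
      rearrange : ∀ i j ℓ → i ℕ.+ (ℓ ℕ.+ j ℕ.* ℓ) ≡ i ℕ.+ j ℕ.* ℓ ℕ.+ ℓ
      rearrange = ℕSolver.solve-∀

    -- As c is ℓ-periodic, one step backwards is ℓ′ = ℓ - 1 steps forwards.
    module _ {ℓ′} (ℓ≡ : ℓ ≡ suc ℓ′) (o : ℕ) where

      private
        per : ∀ i j → c (i ℕ.+ j ℕ.* suc ℓ′) ≡ c i
        per i j = trans (cong (λ l → c (i ℕ.+ j ℕ.* l)) (sym ℓ≡)) (periodic* i j)

      forward : ℕ → Mat n
      forward i = c (i ℕ.+ o)

      backward : ℕ → Mat n
      backward i = c (i ℕ.* ℓ′ ℕ.+ o)

      forward-walk : Iso (c o) Q → ReducedWalk Q forward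
      forward-walk home = record
        { adjacent = λ i → λ _ → Adj⇒μ (adjacent (i ℕ.+ o))
        ; noBack   = λ i φ → noEdgeRep (i ℕ.+ o) (Iso⇒≅ φ)
        -- `i * ℓ′` further steps complete the `i` steps made to `i` full periods.
        ; recurs   = λ i → i ℕ.* ℓ′ , subst (λ X → Iso X Q)
            (sym (trans (cong c (rearrange i ℓ′ o)) (per o i))) home
        }
        where
        rearrange : ∀ i l o → i ℕ.* l ℕ.+ i ℕ.+ o ≡ o ℕ.+ i ℕ.* suc l
        rearrange = ℕSolver.solve-∀

      backward-walk : Iso (c o) Q → ReducedWalk Q backward
      backward-walk home = record
        { adjacent = λ i _ → Adj⇒μ (Adj-sym (subst (Adj _) (step i) (adjacent (suc i ℕ.* ℓ′ ℕ.+ o))))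
        ; noBack   = λ i φ → noEdgeRep (suc (suc i) ℕ.* ℓ′ ℕ.+ o)
            (Iso⇒≅ (subst (Iso _) (sym (twoSteps i)) (Iso-sym φ)))
        ; recurs   = λ i → i ℕ.* ℓ′ , subst (λ X → Iso X Q) (sym (round i)) home
        }
        where
        round : ∀ i → c ((i ℕ.* ℓ′ ℕ.+ i) ℕ.* ℓ′ ℕ.+ o) ≡ c o
        round i = trans (cong c (rearrange i ℓ′ o)) (per o (i ℕ.* ℓ′))
          where
          rearrange : ∀ i l o → (i ℕ.* l ℕ.+ i) ℕ.* l ℕ.+ o ≡ o ℕ.+ i ℕ.* l ℕ.* suc l
          rearrange = ℕSolver.solve-∀
        step : ∀ i → c (suc (suc i ℕ.* ℓ′ ℕ.+ o)) ≡ c (i ℕ.* ℓ′ ℕ.+ o)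
        step i = trans (cong c (rearrange i ℓ′ o)) (per (i ℕ.* ℓ′ ℕ.+ o) 1)
          where
          rearrange : ∀ i l o → suc (suc i ℕ.* l ℕ.+ o) ≡ i ℕ.* l ℕ.+ o ℕ.+ 1 ℕ.* suc l
          rearrange = ℕSolver.solve-∀
        twoSteps : ∀ i → c (suc (suc (suc (suc i) ℕ.* ℓ′ ℕ.+ o))) ≡ c (i ℕ.* ℓ′ ℕ.+ o)
        twoSteps i = trans (cong c (rearrange i ℓ′ o)) (per (i ℕ.* ℓ′ ℕ.+ o) 2)
          where
          rearrange : ∀ i l o → suc (suc (suc (suc i) ℕ.* l ℕ.+ o)) ≡ i ℕ.* l ℕ.+ o ℕ.+ 2 ℕ.* suc l
          rearrange = ℕSolver.solve-∀

      meet : ∀ i j → i ℕ.+ j ≡ suc ℓ′ → forward i ≡ backward j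
      meet i zero    eq = trans (cong (λ i → c (i ℕ.+ o)) (trans (sym (ℕ.+-identityʳ i)) eq))
        (trans (cong c (rearrange ℓ′ o)) (per o 1))
        where
        rearrange : ∀ l o → suc l ℕ.+ o ≡ o ℕ.+ 1 ℕ.* suc l
        rearrange = ℕSolver.solve-∀
      meet i (suc j) eq = sym (trans (cong (λ l → c (suc j ℕ.* l ℕ.+ o)) (sym ℓ′≡))
          (trans (cong c (rearrange i j o)) (trans (cong (λ l → c (i ℕ.+ o ℕ.+ j ℕ.* suc l)) ℓ′≡) (per (i ℕ.+ o) j))))
        where
        ℓ′≡ : i ℕ.+ j ≡ ℓ′
        ℓ′≡ = ℕ.suc-injective (trans (sym (ℕ.+-suc i j)) eq)
        rearrange : ∀ i j o → suc j ℕ.* (i ℕ.+ j) ℕ.+ o ≡ i ℕ.+ o ℕ.+ j ℕ.* suc (i ℕ.+ j)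
        rearrange = ℕSolver.solve-∀

      turns : ∀ {X} → Iso X (forward 1) → ¬ Iso X (backward 1)
      turns φ ψ = noEdgeRep (ℓ′ ℕ.+ o) (Iso⇒≅ (Iso-trans
        (subst (λ l → Iso (c (l ℕ.+ o)) _) (ℕ.+-identityʳ ℓ′) (Iso-sym ψ))
        (subst (Iso _) (sym (trans (cong c (rearrange ℓ′ o)) (per (suc o) 1))) φ)))
        where
        rearrange : ∀ l o → suc (suc (l ℕ.+ o)) ≡ suc o ℕ.+ 1 ℕ.* suc l
        rearrange = ℕSolver.solve-∀

  -- The parity of the number of times a walk traverses a given edge of Γ is a homotopy invariant
  -- as soon as no 2-cell touches one endpoint Q of that edge. Membership in a class of Γ is not
  -- decided here, so the parity is a relation, and its existence is only shown to be not absurd.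
  module Parity {n} (Q : Mat n) (E : Mat n → Mat n → Set)
    (E-sym : ∀ {u v} → E u v → E v u)
    (E-resp : ∀ {u v u′ v′} → u ≅ u′ → v ≅ v′ → E u v → E u′ v′)
    (E-end : ∀ {u v} → E u v → (u ≅ Q) ⊎ (v ≅ Q)) where

    data Par : List (Mat n) → Bool → Set where
      none    : Par [] false
      single  : ∀ {u} → Par (u ∷ []) false
      on-edge : ∀ {u v w b} → E u v → Par (v ∷ w) b → Par (u ∷ v ∷ w) (not b)
      off     : ∀ {u v w b} → ¬ E u v → Par (v ∷ w) b → Par (u ∷ v ∷ w) b

    Par-unique : ∀ {w b b′} → Par w b → Par w b′ → b ≡ b′
    Par-unique none          none           = refl
    Par-unique single        single         = refl
    Par-unique (on-edge e p) (on-edge e′ q) = cong not (Par-unique p q)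
    Par-unique (on-edge e p) (off ¬e q)     = contradiction e ¬e
    Par-unique (off ¬e p)    (on-edge e q)  = contradiction e ¬e
    Par-unique (off ¬e p)    (off ¬e′ q)    = Par-unique p q

    Par-exists : ∀ w → ¬ ¬ (∃ λ b → Par w b)
    Par-exists []          k = k (false , none)
    Par-exists (u ∷ [])    k = k (false , single)
    Par-exists (u ∷ v ∷ w) k = Par-exists (v ∷ w) λ (b , p) →
      k (b , off (λ e → k (not b , on-edge e p)) p)

    Par-resp : ∀ {w w′ b} → Pointwise _≅_ w w′ → Par w b → Par w′ b
    Par-resp []             none          = none
    Par-resp (_ ∷ [])       single        = single
    Par-resp (r ∷ r′ ∷ rs)  (on-edge e p) = on-edge (E-resp r r′ e) (Par-resp (r′ ∷ rs) p)
    Par-resp (r ∷ r′ ∷ rs)  (off ¬e p)    =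
      off (λ e → ¬e (E-resp (≅-sym r) (≅-sym r′) e)) (Par-resp (r′ ∷ rs) p)

    Par-prefix : ∀ xs {u w w′} → (∀ {b} → Par (u ∷ w) b → Par (u ∷ w′) b) →
      ∀ {b} → Par (xs ++ u ∷ w) b → Par (xs ++ u ∷ w′) b
    Par-prefix []            f p             = f p
    Par-prefix (x ∷ [])      f (on-edge e p) = on-edge e (f p)
    Par-prefix (x ∷ [])      f (off ¬e p)    = off ¬e (f p)
    Par-prefix (x ∷ x′ ∷ xs) f (on-edge e p) = on-edge e (Par-prefix (x′ ∷ xs) f p)
    Par-prefix (x ∷ x′ ∷ xs) f (off ¬e p)    = off ¬e (Par-prefix (x′ ∷ xs) f p)

    Par-back : ∀ {u v w b} → Par (u ∷ v ∷ u ∷ w) b → Par (u ∷ w) b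
    Par-back {u} {w = w} (on-edge e (on-edge e′ p)) = subst (Par (u ∷ w)) (sym (not-involutive _)) p
    Par-back (on-edge e (off ¬e p))  = contradiction (E-sym e) ¬e
    Par-back (off ¬e (on-edge e p))  = contradiction (E-sym e) ¬e
    Par-back (off ¬e (off ¬e′ p))    = p

    -- By `E-end` a counted edge meets the class of `Q`, so a detour avoiding this class contributes
    -- nothing.
    Par-away : ∀ {u v} zs {w b} → ¬ (u ≅ Q) → ¬ (v ≅ Q) → All (λ z → ¬ (z ≅ Q)) zs →
      Par (u ∷ zs ++ v ∷ w) b → Par (v ∷ w) b
    Par-away []       u≇ v≇ _           (off _ p)     = p
    Par-away (z ∷ zs) u≇ v≇ (z≇ ∷ zs≇)  (off _ p)     = Par-away zs z≇ v≇ zs≇ p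
    Par-away []       u≇ v≇ _           (on-edge e p) with E-end e
    ... | inj₁ u≅ = contradiction u≅ u≇
    ... | inj₂ v≅ = contradiction v≅ v≇
    Par-away (z ∷ zs) u≇ v≇ (z≇ ∷ _)    (on-edge e p) with E-end e
    ... | inj₁ u≅ = contradiction u≅ u≇
    ... | inj₂ z≅ = contradiction z≅ z≇

    module _ {L} (away : ∀ ℓ c → ℓ ℕ.≤ L → IsCycle Q ℓ c → ∀ i → ¬ (c i ≅ Q)) where

      HStep-Par : ∀ {w w′ b b′} → HStep Q L w w′ → Par w b → Par w′ b′ → b ≡ b′
      HStep-Par (rep r) p q = Par-unique (Par-resp r p) q
      HStep-Par (back xs u v ys _ _) p q = Par-unique p (Par-prefix xs Par-back q)
      HStep-Par (cell xs u ys ℓ c ℓ≤L C refl) p q = Par-unique p (Par-prefix xs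
        (Par-away (map c (drop 1 (upTo ℓ))) (c≇ 0) (c≇ 0)
          (map⁺ (All.universal c≇ (drop 1 (upTo ℓ))))) q)
        where c≇ = away ℓ c ℓ≤L C

      odd⇒¬PavedBy : ∀ {w} → Par w true → ¬ PavedBy Q L w
      odd⇒¬PavedBy p ε with Par-unique p single
      ... | ()
      -- The goal is empty, so existence of a parity up to double negation suffices.
      odd⇒¬PavedBy p (fwd h ◅ hs) = Par-exists _ λ (b , q) →
        odd⇒¬PavedBy (subst (Par _) (sym (HStep-Par h p q)) q) hs
      odd⇒¬PavedBy p (bwd h ◅ hs) = Par-exists _ λ (b , q) →
        odd⇒¬PavedBy (subst (Par _) (HStep-Par h q p) q) hs

  -- The mutation cycle

  alt12-steps : ∀ {E : Mat (2 ℕ.+ n) → Mat (2 ℕ.+ n) → Set} k {B} →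
    (∀ t → t ℕ.< k ℕ.* 2 → E (orbit B t) (orbit B (suc t))) → Steps E (alt12 k) B
  alt12-steps zero        e = []
  alt12-steps {E = E} (suc k) {B} e = e 0 (s≤s z≤n) ∷ e 1 (s≤s (s≤s z≤n)) ∷ alt12-steps k λ t t< →
    subst₂ E (sym (orbit-shift B t)) (sym (orbit-shift B (suc t))) (e (2 ℕ.+ t) (s≤s (s≤s t<)))

  module Main {m} (k′ : ℕ) {a : ℤ} {D : Fin (suc m) → Fin (suc m) → ℤ}
    (x y s : Fin (suc m) → ℤ) (p₀ q₀ : ℤ)
    (2≤a : + 2 ≤ a) (2≤D : ∀ {i j} → i Fin.< j → + 2 ≤ D i j)
    (2≤x : ∀ i → + 2 ≤ x i) (2≤y : ∀ i → + 2 ≤ y i) (2≤s : ∀ i → + 2 ≤ s i)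
    (2≤p₀ : + 2 ≤ p₀) (2≤q₀ : + 2 ≤ q₀) where

    module O = Orbits k′ x y s p₀ q₀ 2≤a 2≤D 2≤x 2≤y 2≤s 2≤p₀ 2≤q₀
    open O using (K; K′; u; v; IsQ)

    module _ {Q : Mat (4 ℕ.+ m)} (SQ : IsQ Q) where

      private
        module Q = State SQ

        N R : Mat (4 ℕ.+ m)
        N = O.N SQ
        R = O.R SQ

        N-quiver : IsQuiver N
        N-quiver = μ-quiver last Q.quiv

      off-short-cycles : ∀ ℓ c → ℓ ℕ.≤ 4 ℕ.* suc k′ ℕ.+ 1 → IsCycle Q ℓ c → ∀ i → ¬ (c i ≅ Q)
      off-short-cycles zero                c ℓ≤ C i ci≅Q with IsCycle.positive C
      ... | ()
      off-short-cycles (suc zero)          c ℓ≤ C i ci≅Q = IsCycle.noVertRep C i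
        (≋⇒≅ (λ u v → cong (λ X → X u v) (sym (trans (cong c (ℕ.+-comm 1 i)) (IsCycle.periodic C i)))))
      off-short-cycles ℓ@(suc ℓ′@(suc _))  c ℓ≤ C i ci≅Q = ℕ.<⇒≱ too-long ℓ≤
        where
        open Cycles C
        home : Iso (c i) Q
        home = ≅⇒Iso ci≅Q
        start : Iso Q (c i)
        start = Iso-sym home
        fw = forward-walk refl i home
        bw = backward-walk refl i home
        bound : suc (K ℕ.+ K) ℕ.< ℓ
        bound = O.two-way-bound SQ fw bw start start (turns refl i) (meet refl i) (s≤s (s≤s z≤n))
        too-long : 4 ℕ.* suc k′ ℕ.+ 1 ℕ.< ℓ
        too-long = subst (ℕ._< ℓ) (double k′) bound
          where
          double : ∀ k → suc (suc k ℕ.* 2 ℕ.+ suc k ℕ.* 2) ≡ 4 ℕ.* suc k ℕ.+ 1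
          double = ℕSolver.solve-∀

      private
        module Sink = SinkSequence a x y s (v (suc K)) (v K) 2≤D 2≤x 2≤y 2≤s

      Edge : Mat (4 ℕ.+ m) → Mat (4 ℕ.+ m) → Set
      Edge A B = (A ≅ Q × B ≅ N) ⊎ (A ≅ N × B ≅ Q)

      private
        ¬Edgeˡ : ∀ {A B} → IsQuiver A → NoSourceSink A → ¬ Edge A B
        ¬Edgeˡ quiv noSS (inj₁ (A≅Q , _)) = O.Q-has-sink SQ (NoSourceSink-Iso (≅⇒Iso A≅Q) quiv noSS)
        ¬Edgeˡ quiv noSS (inj₂ (A≅N , _)) = O.N-has-source SQ (NoSourceSink-Iso (≅⇒Iso A≅N) quiv noSS)

        ¬Edgeʳ : ∀ {A B} → IsQuiver B → NoSourceSink B → ¬ Edge A B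
        ¬Edgeʳ quiv noSS (inj₁ (_ , B≅N)) = O.N-has-source SQ (NoSourceSink-Iso (≅⇒Iso B≅N) quiv noSS)
        ¬Edgeʳ quiv noSS (inj₂ (_ , B≅Q)) = O.Q-has-sink SQ (NoSourceSink-Iso (≅⇒Iso B≅Q) quiv noSS)

        T-state : ∀ {S} → Sink.IsS 0 S →
          State a D v₂ v₁ (λ i → - y i) (λ i → - x i) (v K) (v (suc K′)) (λ i → s i + - - y i * v K) (μ v₂ S)
        T-state S = State-subst
          (mutate-Q-neg O.0≤a (Sink.S-end S) (λ i → neg≤0 (2≤⇒0≤ (2≤y i))) (2≤⇒0≤ (O.2≤v (suc K′))))
          (λ _ → refl) (λ _ → refl) refl (W-back a (v (suc K′)) (v K)) (λ _ → refl)

        A-state : ∀ {S} → Sink.IsS 0 S →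
          State a D v₁ v₂ (λ i → u i 0) (λ i → u i 1) (v (suc K′)) (v K′) O.c₂ (μ v₁ (μ v₂ S))
        A-state S = State-subst
          (mutate-Q-neg O.0≤a (T-state S) (λ i → neg≤0 (2≤⇒0≤ (2≤x i))) (2≤⇒0≤ (O.2≤v K′)))
          (λ _ → refl) (λ i → neg-involutive (y i)) refl (W-back a (v K′) (v (suc K′))) weight
          where
          -- The left side collects arrows at 2 and then at 1 after the sink mutations, the right
          -- side at 1 and then at 2 on the path from `Q`.
          weight : ∀ i → s i + - - y i * v K + - - x i * v (suc K′) ≡ O.c₂ i
          weight i = trans (before (s i) (x i) (y i) (v K) (v (suc K′)))
              (trans (cong (λ z → s i + z) (W-cross-swap a {x i} {y i} {q₀} {p₀} (suc K′)))
                (after (s i) (u i K) (v 1) (u i (suc K′)) (v 0)))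
            where
            before : ∀ s x y v w → s + - - y * v + - - x * w ≡ s + (y * v - (- x) * w)
            before = solve-∀
            after : ∀ s u v u′ v′ → s + (u * v - u′ * v′) ≡ s + u * v + u′ * (- v′)
            after = solve-∀

        -- This closes the mutation cycle: the way back from `R` arrives at the end of the second
        -- path, which the remaining letters retrace to `Q`.
        A≋Y : ∀ {S} → Sink.IsS 0 S → μ v₁ (μ v₂ S) ≋ orbit Q K
        A≋Y S = State-unique (A-state S)
          (subst₂ (λ p q → State a D p q (λ i → u i 0) (λ i → u i 1) (v (suc K′)) (v K′) O.c₂ (orbit Q K))
            (alternate-even k′) (alternate-odd k′)
            (O.Y-state SQ K′ 0 (ℕ.+-identityʳ K′)))

        T-noSourceSink : ∀ {S} → Sink.IsS 0 S → NoSourceSink (μ v₂ S)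
        T-noSourceSink S = NoSourceSink-end T 2≤a (λ i → subst (+ 2 ≤_) (sym (neg-involutive _)) (2≤y i)) (O.2≤v (suc K′))
            (λ i → ≤-trans (O.2≤v (suc K′)) (<⇒≤ (proj₂ (dominates-nonneg
              (subst (+ 2 ≤_) (sym (neg-involutive _)) (2≤y i)) (O.2≤v (suc K′)) (2≤⇒0≤ (2≤s i))))))
            (last , subst (+ 2 ≤_) (sym (State.ql T)) (O.2≤v K′))
          where T = T-state S

        countdown-home : ∀ t {B} → B ≋ orbit Q t → μs (countdown t) B ≋ Q
        countdown-home zero    eq = eq
        countdown-home (suc t) eq = countdown-home t
          (≋-trans (μ-cong (alternate t) eq) (μ-involutive (alternate t) (orbit Q t)))

        ¬Edges : List (Fin (4 ℕ.+ m)) → Mat (4 ℕ.+ m) → Set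
        ¬Edges = Steps (λ A B → ¬ Edge A B)

        countdown-steps : ∀ t {B} → t ℕ.≤ K → B ≋ orbit Q t → ¬Edges (countdown t) B
        countdown-steps zero    t≤ eq = []
        countdown-steps (suc t) t≤ eq =
            ¬Edgeˡ (Iso-quiver φ (orbit-quiver Q.quiv (suc t)))
              (NoSourceSink-Iso φ (orbit-quiver Q.quiv (suc t)) (O.NoSourceSink-Y SQ t t≤))
          ∷ countdown-steps t (ℕ.<⇒≤ t≤)
              (≋-trans (μ-cong (alternate t) eq) (μ-involutive (alternate t) (orbit Q t)))
          where φ = ≋⇒Iso (≋-sym eq)

        X-steps : ¬Edges (alt12 (suc k′)) N
        X-steps = alt12-steps (suc k′) step
          where
          step : ∀ t → t ℕ.< K → ¬ Edge (orbit N t) (orbit N (suc t))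
          -- This edge starts at `N` itself, so it is told apart by its other end.
          step zero    _  = ¬Edgeʳ (orbit-quiver N-quiver 1) (O.NoSourceSink-X′ SQ 0 (s≤s (s≤s z≤n)))
          step (suc t) t< = ¬Edgeˡ (orbit-quiver N-quiver (suc t)) (O.NoSourceSink-X′ SQ t t<)

        module FourVertices {B} (SB : Sink.IsS 1 B) where

          private
            module B = State SB

          -- For n = 4 the multiplicities among 1, 2, 4 are `a`, `v K` and `v (K + 1)`, and the last
          -- two exceed `a`; so an isomorphism has to preserve the pair 1, 2.
          joined-by-a : ∀ {w z} → w ≢ mid zero → z ≢ mid zero → B w z ≡ a → m ≡ 0 → w ≡ v₁ × z ≡ v₂
          joined-by-a {w} {z} w≢ z≢ eq refl = go (classify B.roles w) (classify B.roles z) w≢ z≢ eq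
            where
            negative : ∀ {b c} {A : Set} → b ≡ - c → b ≡ a → + 2 ≤ c → A
            negative p refl q = contradiction q (2≤-asym p 2≤a)
            larger : ∀ {b c} {A : Set} → b ≡ c → b ≡ a → a < c → A
            larger refl refl q = contradiction q (<-irrefl refl)
            loop : ∀ {w} {A : Set} → B w w ≡ a → A
            loop {w} eq = contradiction (subst (+ 2 ≤_) (sym eq) 2≤a) (Arr-irrefl B.quiv {w})
            go : ∀ {w z} → Class {0} v₁ v₂ w → Class v₁ v₂ z → w ≢ mid zero → z ≢ mid zero → B w z ≡ a → w ≡ v₁ × z ≡ v₂
            go (isMid zero) _ w≢ _ _ = contradiction refl w≢
            go _ (isMid zero) _ z≢ _ = contradiction refl z≢
            go isP    isP    _ _ eq = loop {v₁} eq
            go isP    isQ    _ _ eq = refl , refl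
            go isP    isLast _ _ eq = negative B.pl eq (O.2≤v K)
            go isQ    isP    _ _ eq = negative B.qp eq 2≤a
            go isQ    isQ    _ _ eq = loop {v₂} eq
            go isQ    isLast _ _ eq = larger B.ql eq (O.a<v K′)
            go isLast isP    _ _ eq = larger B.lp eq (O.a<v (suc K′))
            go isLast isQ    _ _ eq = negative B.lq eq (O.2≤v (suc K′))
            go isLast isLast _ _ eq = loop {last} eq

          mid-sink : ∀ {z} → m ≡ 0 → ¬ Arr B (mid zero) z
          mid-sink {z} refl = go (classify B.roles z)
            where
            negative : ∀ {b c} → b ≡ - c → + 2 ≤ c → ¬ (+ 2 ≤ b)
            negative p q r = 2≤-asym p r q
            go : ∀ {z} → Class {0} v₁ v₂ z → ¬ Arr B (mid zero) z
            go isP          = negative (B.mp zero) (2≤x zero)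
            go isQ          = negative (trans (B.mq zero) (neg-involutive _)) (2≤y zero)
            go (isMid zero) = Arr-irrefl B.quiv {mid zero}
            go isLast       = negative (B.ml zero) (2≤s zero)

          -- The sink 3 of `B` is matched with the sink 4 of `Q`, so the sign is `pos`, 1 and 2 are
          -- fixed, and 3 and 4 are exchanged. This would give `v K = u (K + 1)` and
          -- `v (K + 1) = u K`, although both sequences increase.
          not-Q : m ≡ 0 → ¬ Iso B Q
          not-Q m≡0 φ@(iso σ s eq) = go s eq
            where
            at-last : σ ⟨$⟩ʳ last ≡ mid zero
            at-last = off-triangle-match φ B.quiv (Sink.mid-not-OnTriangle {1} SB zero) (O.Q-OnTriangle SQ)
            ≢mid : ∀ {z} → z ≢ last → σ ⟨$⟩ʳ z ≢ mid zero
            ≢mid z≢ e = z≢ (Iso.σ-injective φ (trans e (sym at-last)))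
            v₁→last : Arr Q v₁ last
            v₁→last = subst (+ 2 ≤_) (sym (trans Q.pl (neg-involutive _))) 2≤p₀
            go : ∀ s → (∀ i j → Q i j ≡ s · B (σ ⟨$⟩ʳ i) (σ ⟨$⟩ʳ j)) → ⊥
            go neg eq = mid-sink m≡0 (subst (λ z → Arr B z (σ ⟨$⟩ʳ v₁)) at-last
              (subst (+ 2 ≤_) (trans (eq v₁ last) (sym (B.quiv _ _))) v₁→last))
            go pos eq with joined-by-a (≢mid (λ ())) (≢mid (λ ())) (trans (sym (eq v₁ v₂)) Q.pq) m≡0
            ... | σ₁ , σ₂ = <-irrefl refl (<-trans (O.u-mono zero (suc K′)) (subst₂ _<_ g f (O.v-mono (suc K′))))
              where
              at-mid : σ ⟨$⟩ʳ mid zero ≡ last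
              at-mid = class-last (classify B.roles _) refl
                where
                class-last : ∀ {z} → Class v₁ v₂ z → σ ⟨$⟩ʳ mid zero ≡ z → z ≡ last
                class-last isP       e = contradiction (Iso.σ-injective φ (trans e (sym σ₁))) (λ ())
                class-last isQ       e = contradiction (Iso.σ-injective φ (trans e (sym σ₂))) (λ ())
                class-last isLast    e = refl
                class-last (isMid i) e = contradiction
                  (Iso.σ-injective φ (trans e (trans (cong mid (only i m≡0)) (sym at-last)))) mid≢last
                  where
                  only : ∀ (i : Fin (suc m)) → m ≡ 0 → i ≡ zero
                  only zero refl = refl
              g : v K ≡ u zero (suc K)
              g = trans (sym B.ql) (trans (sym (cong₂ B σ₂ at-mid)) (trans (sym (eq v₂ (mid zero))) (Q.qm zero)))
              f : v (suc K) ≡ u zero K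
              f = trans (sym B.lp) (trans (sym (cong₂ B at-mid σ₁)) (trans (sym (eq (mid zero) v₁)) (Q.mp zero)))

          -- The sink 3 is now matched with the source 4 of `N`, so arrows are reversed and 1, 2
          -- exchanged. The arrows `4 → 1` of `N` are then compared with the arrows `2 → 3` of `B`.
          not-N : m ≡ 0 → p₀ ≢ y zero → ¬ Iso B N
          not-N m≡0 p₀≢y φ@(iso σ s eq) = go s eq
            where
            module N = State (O.X-state SQ 0 K refl)
            at-last : σ ⟨$⟩ʳ last ≡ mid zero
            at-last = off-triangle-match φ B.quiv (Sink.mid-not-OnTriangle {1} SB zero) (O.N-OnTriangle SQ)
            ≢mid : ∀ {z} → z ≢ last → σ ⟨$⟩ʳ z ≢ mid zero
            ≢mid z≢ e = z≢ (Iso.σ-injective φ (trans e (sym at-last)))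
            go : ∀ s → (∀ i j → N i j ≡ s · B (σ ⟨$⟩ʳ i) (σ ⟨$⟩ʳ j)) → ⊥
            go pos eq = mid-sink m≡0 (subst (λ z → Arr B z (σ ⟨$⟩ʳ v₁)) at-last
              (subst (+ 2 ≤_) (trans (sym N.lp) (eq last v₁)) 2≤p₀))
            go neg eq with joined-by-a (≢mid (λ ())) (≢mid (λ ()))
              (trans (B.quiv (σ ⟨$⟩ʳ v₂) (σ ⟨$⟩ʳ v₁)) (trans (sym (eq v₁ v₂)) N.pq)) m≡0
            ... | σ₂ , σ₁ = p₀≢y (trans (sym N.lp) (trans (eq last v₁) (trans (sym (B.quiv _ _))
                    (trans (cong₂ B σ₁ at-last) (trans (B.qm zero) (neg-involutive _))))))

        two-mids : 1 ℕ.≤ m → ∀ θ {S} → Sink.IsS θ S → ¬ Iso S Q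
        two-mids (s≤s z≤n) θ SS φ = contradiction (mid-injective (trans (sym (at zero)) (at (suc zero)))) (λ ())
          where
          at : ∀ i → Iso.σ φ ⟨$⟩ʳ last ≡ mid i
          at i = off-triangle-match φ (State.quiv SS) (Sink.mid-not-OnTriangle {θ} SS i) (O.Q-OnTriangle SQ)

        -- For n at least 5 it is enough to keep `Q` away from both ends; for n = 4 there is a
        -- single sink mutation, and its starting quiver is neither `Q` nor `N`.
        not-QN-edge : 1 ℕ.≤ m ⊎ (m ≡ 0 × p₀ ≢ y zero) → ∀ {θ A B} → θ ℕ.< suc m →
          Sink.IsS (suc θ) A → Sink.IsS θ B → ¬ Edge A B
        not-QN-edge (inj₁ 1≤m) {θ} _ SA SB (inj₁ (A≅Q , _)) = two-mids 1≤m (suc θ) SA (≅⇒Iso A≅Q)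
        not-QN-edge (inj₁ 1≤m) {θ} _ SA SB (inj₂ (_ , B≅Q)) = two-mids 1≤m θ SB (≅⇒Iso B≅Q)
        not-QN-edge (inj₂ (m≡0 , p₀≢y)) {θ} θ< SA SB e = go θ (subst (λ m → θ ℕ.< suc m) m≡0 θ<) SA e
          where
          go : ∀ θ {A B} → θ ℕ.< 1 → Sink.IsS (suc θ) A → ¬ Edge A B
          go zero _ SA (inj₁ (A≅Q , _)) = FourVertices.not-Q SA m≡0 (≅⇒Iso A≅Q)
          go zero _ SA (inj₂ (A≅N , _)) = FourVertices.not-N SA m≡0 p₀≢y (≅⇒Iso A≅N)
          go (suc θ) (s≤s ())

      private
        home-word : List (Fin (4 ℕ.+ m))
        home-word = (reverse mids ++ v₂ ∷ v₁ ∷ []) ++ countdown K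

        cycle : List (Fin (4 ℕ.+ m))
        cycle = last ∷ (alt12 (suc k′) ++ (downFrom (3 ℕ.+ m) ++ alt21 (suc k′)))

        cycle-words : cycle ≡ last ∷ (alt12 (suc k′) ++ home-word)
        cycle-words = cong₂ (λ xs ys → last ∷ (alt12 (suc k′) ++ (xs ++ ys))) (downFrom-mids m) (alt21-countdown (suc k′))

        R≡ : μs (alt12 (suc k′)) N ≡ R
        R≡ = alt12-orbit (suc k′) N

      module _ (condition : 1 ℕ.≤ m ⊎ (m ≡ 0 × p₀ ≢ y zero)) where

        private
          S : Mat (4 ℕ.+ m)
          S = μs (reverse mids) R

          S-phase : Sink.IsS 0 S × ¬Edges (reverse mids) R
          S-phase = Sink.S-sequence (not-QN-edge condition) (Sink.S-start (O.R-state SQ))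

          home≋ : ∀ {B} → B ≡ μs home-word R → B ≋ Q
          home≋ refl rewrite μs-++ (reverse mids ++ v₂ ∷ v₁ ∷ []) (countdown K) R
                           | μs-++ (reverse mids) (v₂ ∷ v₁ ∷ []) R = countdown-home K (A≋Y (proj₁ S-phase))

          home-steps : ¬Edges home-word R
          home-steps = Steps-++ (Steps-++ (proj₂ S-phase)
              (¬Edgeʳ (State.quiv T) T-noSS ∷ (¬Edgeˡ (State.quiv T) T-noSS ∷ [])))
              (subst (¬Edges (countdown K)) (sym (μs-++ (reverse mids) (v₂ ∷ v₁ ∷ []) R))
                (countdown-steps K ℕ.≤-refl (A≋Y (proj₁ S-phase))))
            where
            T = T-state (proj₁ S-phase)
            T-noSS = T-noSourceSink (proj₁ S-phase)

        cycle-closes : μs cycle Q ≋ Q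
        cycle-closes = home≋ (trans (cong (λ ks → μs ks Q) cycle-words)
          (trans (μs-++ (alt12 (suc k′)) home-word N) (cong (μs home-word) R≡)))

        not-paved : ¬ PavedBy Q (4 ℕ.* suc k′ ℕ.+ 1) (walkOf cycle Q)
        not-paved = odd⇒¬PavedBy off-short-cycles (subst (λ ks → Par (walkOf ks Q) true) (sym cycle-words) odd)
          where
          E-sym : ∀ {A B} → Edge A B → Edge B A
          E-sym (inj₁ (p , q)) = inj₂ (q , p)
          E-sym (inj₂ (p , q)) = inj₁ (q , p)
          E-resp : ∀ {A B A′ B′} → A ≅ A′ → B ≅ B′ → Edge A B → Edge A′ B′
          E-resp a b (inj₁ (p , q)) = inj₁ (≅-sym a ◅◅ p , ≅-sym b ◅◅ q)
          E-resp a b (inj₂ (p , q)) = inj₂ (≅-sym a ◅◅ p , ≅-sym b ◅◅ q)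
          E-end : ∀ {A B} → Edge A B → (A ≅ Q) ⊎ (B ≅ Q)
          E-end (inj₁ (p , _)) = inj₁ p
          E-end (inj₂ (_ , q)) = inj₂ q
          open Parity Q Edge E-sym E-resp E-end
          even : ∀ ks {B} → ¬Edges ks B → Par (walkOf ks B) false
          even []           []       = single
          even (k ∷ [])     (e ∷ es) = off e (even [] es)
          even (k ∷ l ∷ ks) (e ∷ es) = off e (even (l ∷ ks) es)
          from-N : ∀ ks {B} → Par (walkOf ks B) false → Edge Q B → Par (Q ∷ walkOf ks B) true
          from-N []       p e = on-edge e p
          from-N (k ∷ ks) p e = on-edge e p
          odd = from-N (alt12 (suc k′) ++ home-word)
            (even (alt12 (suc k′) ++ home-word)
              (Steps-++ X-steps (subst (¬Edges home-word) (sym R≡) home-steps))) (inj₁ (ε , ε))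

  -- The weights of `Q` obtained from `R̃`

  wound-state : ∀ {m a D} {x y : Fin (suc m) → ℤ} → + 2 ≤ a → (∀ i → + 2 ≤ x i) → (∀ i → + 2 ≤ y i) → ∀ k t {B} →
    Wound a D v₁ v₂ (λ i → W a (x i) (y i) t) (λ i → W a (x i) (y i) (suc t)) B →
    Wound a D v₁ v₂ (λ i → W a (x i) (y i) (k ℕ.* 2 ℕ.+ t)) (λ i → W a (x i) (y i) (suc (k ℕ.* 2 ℕ.+ t))) (μs (alt21 k) B)
  wound-state 2≤a 2≤x 2≤y zero    t S = S
  wound-state {a = a} {D} {x} {y} 2≤a 2≤x 2≤y (suc k) t {B} S =
    subst (λ e → Wound a D v₁ v₂ (λ i → W a (x i) (y i) e) (λ i → W a (x i) (y i) (suc e)) (μs (alt21 (suc k)) B))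
      (trans (ℕ.+-suc (k ℕ.* 2) (suc t)) (cong suc (ℕ.+-suc (k ℕ.* 2) t)))
      (wound-state {x = x} {y} 2≤a 2≤x 2≤y k (suc (suc t))
        (Wound-mutate 0≤a (λ i → 2≤⇒0≤ (2≤W 2≤a (2≤x i) (2≤y i) (suc t)))
          (Wound-mutate 0≤a (λ i → 2≤⇒0≤ (2≤W 2≤a (2≤x i) (2≤y i) t)) S)))
    where 0≤a = 2≤⇒0≤ 2≤a

  module Theorem {m} (k′ : ℕ) (R̃ : Mat (3 ℕ.+ m)) (R̃-quiver : IsQuiver R̃)
    (2≤R̃ : ∀ i j → i Fin.< j → + 2 ≤ R̃ i j)
    (Q : Mat (4 ℕ.+ m)) (Q-quiver : IsQuiver Q)
    (restrict : ∀ i j → Q (inject₁ i) (inject₁ j) ≡ μs (alt21 (suc k′)) R̃ i j)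
    (2≤Q : ∀ i → + 2 ≤ Q (inject₁ i) last) where

    private
      x y s : Fin (suc m) → ℤ
      x i = R̃ v₁ (suc (suc i))
      y i = R̃ v₂ (suc (suc i))
      s i = Q (mid i) last

      a : ℤ
      a = R̃ v₁ v₂

      D : Fin (suc m) → Fin (suc m) → ℤ
      D i j = R̃ (suc (suc i)) (suc (suc j))

      K : ℕ
      K = suc k′ ℕ.* 2

      2≤a : + 2 ≤ a
      2≤a = 2≤R̃ v₁ v₂ (s≤s z≤n)
      2≤x : ∀ i → + 2 ≤ x i
      2≤x i = 2≤R̃ _ _ (s≤s z≤n)
      2≤y : ∀ i → + 2 ≤ y i
      2≤y i = 2≤R̃ _ _ (s≤s (s≤s z≤n))
      2≤D : ∀ {i j} → i Fin.< j → + 2 ≤ D i j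
      2≤D i<j = 2≤R̃ _ _ (s≤s (s≤s i<j))

      wound : Wound a D v₁ v₂ (λ i → W a (x i) (y i) K) (λ i → W a (x i) (y i) (suc K)) (μs (alt21 (suc k′)) R̃)
      wound = subst
        (λ e → Wound a D v₁ v₂ (λ i → W a (x i) (y i) e) (λ i → W a (x i) (y i) (suc e)) (μs (alt21 (suc k′)) R̃))
        (ℕ.+-identityʳ K) (wound-state {x = x} {y} 2≤a 2≤x 2≤y (suc k′) 0 record
          { roles = r₁₂ ; quiv = R̃-quiver ; pq = refl ; mp = λ i → R̃-quiver _ _ ; qm = λ _ → refl
          ; mm = λ _ _ → refl })

      open Main k′ x y s (Q v₁ last) (Q v₂ last) 2≤a 2≤D 2≤x 2≤y (λ i → 2≤Q _) (2≤Q v₁) (2≤Q v₂)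

      Q-state : O.IsQ Q
      Q-state = record
        { roles = r₁₂ ; quiv = Q-quiver
        ; pq = trans (restrict v₁ v₂) pq
        ; mp = λ i → trans (restrict _ v₁) (mp i)
        ; qm = λ i → trans (restrict v₂ _) (qm i)
        ; lp = Q-quiver last v₁
        ; ql = sym (neg-involutive _)
        ; mm = λ i j → trans (restrict _ _) (mm i j)
        ; ml = λ _ → refl }
        where open Wound wound

      Condition : Set
      Condition = 1 ℕ.≤ m ⊎ (m ≡ 0 × ¬ (Q v₁ last ≡ μs (last ∷ alt12 (suc k′)) Q v₂ (mid zero)))

      condition : Condition → 1 ℕ.≤ m ⊎ (m ≡ 0 × Q v₁ last ≢ y zero)
      condition (inj₁ 1≤m)        = inj₁ 1≤m
      -- In `R` the weights at 3 are those of `R̃` again, so `y zero` is the entry of `R` at 2, 3.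
      condition (inj₂ (m≡0 , ne)) = inj₂ (m≡0 , λ eq → ne (trans eq
        (sym (trans (cong (λ B → B v₂ (mid zero)) (alt12-orbit (suc k′) (μ last Q)))
          (State.qm (O.R-state Q-state) zero)))))

    short-cycles-avoid-Q : ∀ ℓ c → ℓ ℕ.≤ 4 ℕ.* suc k′ ℕ.+ 1 → IsCycle Q ℓ c → ∀ i → ¬ (c i ≅ Q)
    short-cycles-avoid-Q = off-short-cycles Q-state

    mutation-cycle-closes : Condition → μs (last ∷ (alt12 (suc k′) ++ (downFrom (3 ℕ.+ m) ++ alt21 (suc k′)))) Q ≅ Q
    mutation-cycle-closes cond = ≋⇒≅ (cycle-closes Q-state (condition cond))

    mutation-cycle-not-paved : Condition →
      ¬ PavedBy Q (4 ℕ.* suc k′ ℕ.+ 1) (walkOf (last ∷ (alt12 (suc k′) ++ (downFrom (3 ℕ.+ m) ++ alt21 (suc k′)))) Q)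
    mutation-cycle-not-paved cond = not-paved Q-state (condition cond)

open import Data.Nat using (ℕ; zero; suc; _+_; _*_; _≤_)
open import Data.Integer using (ℤ; +_)
open import Data.Fin using (Fin; zero; suc; _<_; inject₁; fromℕ)
open import Data.List using (List; _∷_; _++_; map)
open import Data.Product using (_×_; _,_)
open import Data.Sum using (_⊎_)
open import Relation.Nullary using (¬_)
open import Relation.Binary.PropositionalEquality using (_≡_)

theorem7p2 : (m k : ℕ) → 1 ≤ k →
  (R̃ : Mat (3 + m)) → IsQuiver R̃ →
  (∀ (i j : Fin (3 + m)) → i < j → + 2 Data.Integer.≤ R̃ i j) →
  (Q : Mat (4 + m)) → IsQuiver Q →
  (∀ (i j : Fin (3 + m)) → Q (inject₁ i) (inject₁ j) ≡ μs (alt21 k) R̃ i j) →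
  (∀ (i : Fin (3 + m)) → + 2 Data.Integer.≤ Q (inject₁ i) (fromℕ (3 + m))) →
  let R = μs (fromℕ (3 + m) ∷ alt12 k) Q
      cyc = fromℕ (3 + m) ∷ (alt12 k ++ (downFrom (3 + m) ++ alt21 k))
  in (1 ≤ m ⊎ (m ≡ 0 × ¬ (Q zero (fromℕ (3 + m)) ≡ R (suc zero) (suc (suc zero))))) →
  (∀ (ℓ : ℕ) (c : ℕ → Mat (4 + m)) → ℓ ≤ 4 * k + 1 → IsCycle Q ℓ c →
     ∀ i → ¬ (c i ≅ Q))
  × (μs cyc Q ≅ Q)
  × ¬ PavedBy Q (4 * k + 1) (walkOf cyc Q)
theorem7p2 m (suc k) 1≤k R̃ R̃-quiver 2≤R̃ Q Q-quiver restrict 2≤Q condition =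
    short-cycles-avoid-Q , mutation-cycle-closes condition , mutation-cycle-not-paved condition
  where open Quivers.Theorem k R̃ R̃-quiver 2≤R̃ Q Q-quiver restrict 2≤Q
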